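{- Let $\mathbb{F}_{q^m}$ be a field extension of $\mathbb{F}=\mathbb{F}_q$ and let $G_i\in\mathbb{F}_{q^m}^{a_i\times n_i}$, $i=1,2$, be matrices of full row rank. Set $G=\begin{pmatrix}G_1&0\\0&G_2\end{pmatrix}\in\mathbb{F}_{q^m}^{(a_1+a_2)\times(n_1+n_2)}$. Let $\mathcal{M}_i=(\mathbb{F}^{n_i},\rho_i)$ and $\mathcal{N}=(\mathbb{F}^{n_1+n_2},\hat\rho)$ be the $q$-matroids represented by $G_1,G_2$ and $G$. Identify $\mathbb{F}^{n_1+n_2}=\mathbb{F}^{n_1}\oplus\mathbb{F}^{n_2}$ in the natural way. (a) If $F=F_1\oplus F_2$ with $F_i$ a flat of $\mathcal{M}_i$, then $F$ is a flat of $\mathcal{N}$. (b) If $O=O_1\oplus O_2$ with $O_i$ an open space of $\mathcal{M}_i$, then $O$ is an open space of $\mathcal{N}$. As a consequence, $\mathcal{Z}(\mathcal{M}_1\oplus\mathcal{M}_2)\subseteq\mathcal{Z}(\mathcal{N})$, and every independent space of $\mathcal{N}$ is an independent space of $\mathcal{M}_1\oplus\mathcal{M}_2$.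
   Context: A $q$-matroid is $\mathcal{M}=(E,\rho)$, $E$ a finite-dimensional $\mathbb{F}_q$-vector space, $\rho$ from subspaces to $\mathbb{Z}_{\ge0}$ with $0\le\rho(V)\le\dim V$, monotone and submodular. For $G\in\mathbb{F}_{q^m}^{k\times n}$ of rank $k$, the $q$-matroid represented by $G$ is $(\mathbb{F}_q^n,\rho)$ with $\rho(V)=\mathrm{rk}(GY^{\mathsf T})$ where $Y$ is any matrix over $\mathbb{F}_q$ with row space $V$. Independent: $\rho(V)=\dim V$. Circuit: dependent subspace all of whose proper subspaces are independent; open: a sum of circuits (empty sum $=0$). Flat: $\rho(F+\langle x\rangle)>\rho(F)$ for all $x\notin F$. Cyclic core: $\mathrm{cyc}(V)=\{x\in V\mid\rho(W)=\rho(V)\text{ for all }W\le V\text{ with }W+\langle x\rangle=V\}$; cyclic: $\mathrm{cyc}(V)=V$ (equivalently, open). $\mathcal{Z}(\mathcal{M})$: set of cyclic flats. Direct sum: for $E=E_1\oplus E_2$ with projections $\pi_i$, $\mathcal{M}_1\oplus\mathcal{M}_2=(E,\rho)$ where $\rho(V)=\dim V+\min_{X\le V}(\rho_1(\pi_1(X))+\rho_2(\pi_2(X))-\dim X)$. -}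

module Defs where

open import Algebra.Bundles using (CommutativeRing)
open import Algebra.Morphism.Structures using (IsRingHomomorphism)
open import Data.Empty using (⊥-elim)
open import Data.Fin.Base as Fin using (Fin; zero; suc; punchIn; splitAt; join; _↑ˡ_; _↑ʳ_)
import Data.Fin.Properties as Fin
open import Data.List.Base as List using (List)
import Data.List.Extrema.Nat as Extrema
open import Data.List.Membership.Propositional using (find; lose)
open import Data.List.Membership.Propositional.Properties using (∈-filter⁺; ∈-upTo⁺)
open import Data.List.Relation.Unary.All as All using (All)
import Data.List.Relation.Unary.All.Properties as All
open import Data.List.Relation.Unary.Any as Any using (Any; here; there)
import Data.List.Relation.Unary.Any.Properties as Any
open import Data.Nat.Base as ℕ using (ℕ; zero; suc; z≤n; s≤s)
import Data.Nat.Properties as ℕ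
open import Data.Nat.Tactic.RingSolver using (solve-∀)
open import Data.Product using (Σ; ∃; _×_; _,_; proj₁; proj₂)
open import Data.Sum.Base as Sum using (_⊎_; inj₁; inj₂)
open import Data.Unit.Base using (⊤)
open import Data.Vec.Functional as Vector
  using (Vector; []; _∷_; _++_; head; tail; take; drop; transpose)
import Data.Vec.Functional.Properties as Vector
open import Function.Base using (_∘_; id)
open import Function.Bundles using (Inverse)
open import Level using (0ℓ)
open import Relation.Binary.Definitions using (_Respects_)
import Relation.Binary.Definitions as B
open import Relation.Binary.PropositionalEquality as ≡ using (_≡_)
open import Relation.Nullary using (¬_; Dec; yes; no)
open import Relation.Nullary.Decidable as Dec using (_×-dec_)
open import Relation.Unary using (Pred; Decidable; _∈_; _∉_; _≐_)

private
  variable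
    k l m n q : ℕ

record FiniteField (q : ℕ) : Set₁ where
  field
    commutativeRing : CommutativeRing 0ℓ 0ℓ
  open CommutativeRing commutativeRing public hiding (zero)
  field
    0≉1         : ¬ 0# ≈ 1#
    inverse     : ∀ x → ¬ x ≈ 0# → ∃ λ y → x * y ≈ 1#
    enumeration : Inverse setoid (≡.setoid (Fin q))

record FieldExtension {q r : ℕ} (𝔽 : FiniteField q) (𝕂 : FiniteField r) : Set where
  private
    module F = FiniteField 𝔽
    module K = FiniteField 𝕂
  field
    embed              : F.Carrier → K.Carrier
    isRingHomomorphism : IsRingHomomorphism F.rawRing K.rawRing embed

tuples : {A : Set} → List A → ∀ k → List (Vector A k)
tuples xs zero    = List.[ [] ]
tuples xs (suc k) = List.cartesianProductWith _∷_ xs (tuples xs k)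

tuples-complete : {A : Set} {R : A → A → Set} (xs : List A) → (∀ x → Any (R x) xs) →
                  (f : Vector A k) → Any (λ g → ∀ i → R (f i) (g i)) (tuples xs k)
tuples-complete {zero}  xs all f = here λ ()
tuples-complete {suc k} xs all f = Any.cartesianProductWith⁺ _∷_
  (λ r rs → λ { zero → r ; (suc i) → rs i }) (all (f zero)) (tuples-complete xs all (f ∘ suc))

module LinearAlgebra {q : ℕ} (𝔽 : FiniteField q) where
  open FiniteField 𝔽 public
  open import Algebra.Properties.Semiring.Sum semiring public
  open import Algebra.Properties.Ring ring public using (-‿distribˡ-*; -‿distribʳ-*; -‿involutive; -‿+-comm; -0#≈0#; -1*x≈-x)
  open import Data.Vec.Functional.Relation.Binary.Equality.Setoid setoid public
    using (_≋_; ≋-refl; ≋-sym; ≋-trans)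
  private module ≈-Reasoning where
    open import Relation.Binary.Reasoning.Setoid setoid public

  Vec : ℕ → Set
  Vec = Vector Carrier

  Matrix : ℕ → ℕ → Set
  Matrix k n = Vector (Vec n) k

  0ᵛ : Vec n
  0ᵛ _ = 0#

  infixl 6 _+ᵛ_ _-ᵛ_
  infixr 7 _·_

  _+ᵛ_ _-ᵛ_ : Vec n → Vec n → Vec n
  (x +ᵛ y) i = x i + y i
  (x -ᵛ y) i = x i - y i

  _·_ : Carrier → Vec n → Vec n
  (c · x) i = c * x i

  infixl 7 _⊗_

  _⊗_ : Matrix k l → Matrix l n → Matrix k n
  _⊗_ {l = l} A B i j = ∑[ h < l ] (A i h * B h j)

  blockDiagonal : Matrix k m → Matrix l n → Matrix (k ℕ.+ l) (m ℕ.+ n)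
  blockDiagonal A B = Vector.map (_++ 0ᵛ) A ++ Vector.map (0ᵛ ++_) B

  lincomb : Vec k → Matrix k n → Vec n
  lincomb {k = k} c Y j = ∑[ i < k ] (c i * Y i j)

  LinearlyIndependent : Matrix k n → Set
  LinearlyIndependent Y = ∀ c → lincomb c Y ≋ 0ᵛ → c ≋ 0ᵛ

  -- Decidability of membership is no restriction classically; it is what makes
  -- dimensions and ranks computable.
  record Subspace (n : ℕ) : Set₁ where
    field
      ⟦_⟧    : Pred (Vec n) 0ℓ
      member? : Decidable ⟦_⟧
      resp    : ⟦_⟧ Respects _≋_
      0∈      : 0ᵛ ∈ ⟦_⟧
      +∈      : ∀ {x y} → x ∈ ⟦_⟧ → y ∈ ⟦_⟧ → x +ᵛ y ∈ ⟦_⟧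
      ·∈      : ∀ c {x} → x ∈ ⟦_⟧ → c · x ∈ ⟦_⟧
  open Subspace public

  infix 4 _≤ₛ_ _≐ₛ_

  _≤ₛ_ _≐ₛ_ : Subspace n → Subspace n → Set
  U ≤ₛ V = ∀ x → x ∈ ⟦ U ⟧ → x ∈ ⟦ V ⟧
  U ≐ₛ V = U ≤ₛ V × V ≤ₛ U

  scalars : List Carrier
  scalars = List.map (Inverse.from enumeration) (List.allFin q)

  scalars-complete : ∀ x → Any (x ≈_) scalars
  scalars-complete x = Any.map⁺ (Any.tabulate⁺ (Inverse.to enumeration x)
    (sym (Inverse.inverseʳ enumeration ≡.refl)))

  infix 4 _≟_ _≟ᵛ_

  _≟_ : B.Decidable _≈_
  x ≟ y = Dec.map′
    (λ e → trans (sym (Inverse.inverseʳ enumeration ≡.refl)) (Inverse.inverseʳ enumeration e))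
    (Inverse.to-cong enumeration)
    (Inverse.to enumeration x Fin.≟ Inverse.to enumeration y)

  _≟ᵛ_ : B.Decidable (_≋_ {n = n})
  x ≟ᵛ y = Fin.all? λ i → x i ≟ y i

  vectors : ∀ n → List (Vec n)
  vectors = tuples scalars

  vectors-complete : (x : Vec n) → Any (x ≋_) (vectors n)
  vectors-complete = tuples-complete scalars scalars-complete

  search : {P : Pred (Vec n) 0ℓ} → P Respects _≋_ → Decidable P → Dec (∃ P)
  search {n = n} {P} P-resp P? = Dec.map′ Any.satisfied
    (λ (x , px) → Any.map (λ x≋y → P-resp x≋y px) (vectors-complete x))
    (Any.any? P? (vectors n))

  matrices : ∀ k n → List (Matrix k n)
  matrices k n = tuples (vectors n) k

  matrices-complete : (Y : Matrix k n) → Any (λ Z → ∀ i → Y i ≋ Z i) (matrices k n)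
  matrices-complete {n = n} = tuples-complete (vectors n) vectors-complete

  lincomb-cong : {c d : Vec k} {Y Z : Matrix k n} → c ≋ d → (∀ i → Y i ≋ Z i) →
                 lincomb c Y ≋ lincomb d Z
  lincomb-cong c≋d Y≋Z j = sum-cong-≋ λ i → *-cong (c≋d i) (Y≋Z i j)

  lincomb-0 : (Y : Matrix k n) → lincomb 0ᵛ Y ≋ 0ᵛ
  lincomb-0 {k = k} Y j = trans (sum-cong-≋ λ i → zeroˡ (Y i j)) (sum-replicate-zero k)

  lincomb-+ : (c d : Vec k) (Y : Matrix k n) →
              lincomb (c +ᵛ d) Y ≋ lincomb c Y +ᵛ lincomb d Y
  lincomb-+ c d Y j = trans (sum-cong-≋ λ i → distribʳ (Y i j) (c i) (d i))
    (∑-distrib-+ (λ i → c i * Y i j) (λ i → d i * Y i j))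

  lincomb-· : ∀ a (c : Vec k) (Y : Matrix k n) → lincomb (a · c) Y ≋ a · lincomb c Y
  lincomb-· a c Y j = trans (sum-cong-≋ λ i → *-assoc a (c i) (Y i j))
    (sym (*-distribˡ-sum a (λ i → c i * Y i j)))

  lincomb-assoc : (c : Vec k) (A : Matrix k l) (Y : Matrix l n) →
                  lincomb c (λ i → lincomb (A i) Y) ≋ lincomb (lincomb c A) Y
  lincomb-assoc {k = k} {l = l} c A Y j = let open ≈-Reasoning in begin
    ∑[ i < k ] (c i * ∑[ h < l ] (A i h * Y h j))
      ≈⟨ sum-cong-≋ (λ i → *-distribˡ-sum (c i) (λ h → A i h * Y h j)) ⟩
    ∑[ i < k ] ∑[ h < l ] (c i * (A i h * Y h j))
      ≈⟨ ∑-comm (λ i h → c i * (A i h * Y h j)) ⟩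
    ∑[ h < l ] ∑[ i < k ] (c i * (A i h * Y h j))
      ≈⟨ sum-cong-≋ (λ h → trans (sum-cong-≋ λ i → sym (*-assoc (c i) (A i h) (Y h j)))
           (sym (*-distribʳ-sum (Y h j) (λ i → c i * A i h)))) ⟩
    ∑[ h < l ] (∑[ i < k ] (c i * A i h) * Y h j) ∎

  lincomb-∈ : (V : Subspace n) (c : Vec k) (Y : Matrix k n) →
              (∀ i → Y i ∈ ⟦ V ⟧) → lincomb c Y ∈ ⟦ V ⟧
  lincomb-∈ {k = zero}  V c Y Y∈ = 0∈ V
  lincomb-∈ {k = suc k} V c Y Y∈ =
    +∈ V (·∈ V (c zero) (Y∈ zero)) (lincomb-∈ V (c ∘ suc) (Y ∘ suc) (Y∈ ∘ suc))

  unit : Fin k → Vec k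
  unit zero    zero    = 1#
  unit zero    (suc j) = 0#
  unit (suc i) zero    = 0#
  unit (suc i) (suc j) = unit i j

  lincomb-unit : (i : Fin k) (Y : Matrix k n) → lincomb (unit i) Y ≋ Y i
  lincomb-unit zero    Y j = trans
    (+-cong (*-identityˡ _) (lincomb-0 (Y ∘ suc) j)) (+-identityʳ _)
  lincomb-unit (suc i) Y j = trans
    (+-cong (zeroˡ _) (lincomb-unit i (Y ∘ suc) j)) (+-identityˡ _)

  𝟎 : Subspace n
  𝟎 = record
    { ⟦_⟧     = _≋ 0ᵛ
    ; member? = _≟ᵛ 0ᵛ
    ; resp    = λ x≋y x≋0 → ≋-trans (≋-sym x≋y) x≋0
    ; 0∈      = ≋-refl
    ; +∈      = λ x≋0 y≋0 i → trans (+-cong (x≋0 i) (y≋0 i)) (+-identityˡ 0#)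
    ; ·∈      = λ c x≋0 i → trans (*-congˡ (x≋0 i)) (zeroʳ c)
    }

  span : Matrix k n → Subspace n
  span Y = record
    { ⟦_⟧     = λ x → ∃ λ c → lincomb c Y ≋ x
    ; member? = λ x → search
        (λ c≋d e → ≋-trans (lincomb-cong (≋-sym c≋d) (λ _ → ≋-refl)) e)
        (λ c → lincomb c Y ≟ᵛ x)
    ; resp    = λ x≋y (c , e) → c , ≋-trans e x≋y
    ; 0∈      = 0ᵛ , lincomb-0 Y
    ; +∈      = λ (c , e) (d , f) → c +ᵛ d ,
        ≋-trans (lincomb-+ c d Y) (λ i → +-cong (e i) (f i))
    ; ·∈      = λ a (c , e) → a · c , ≋-trans (lincomb-· a c Y) (λ i → *-congˡ (e i))
    }

  ⟨_⟩ : Vec n → Subspace n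
  ⟨ x ⟩ = span (x ∷ [])

  rowSpace : Matrix k n → Subspace n
  rowSpace = span

  columnSpace : Matrix k n → Subspace k
  columnSpace A = span (transpose A)

  infixl 6 _+ₛ_
  infixl 7 _∩ₛ_

  +-interchange : ∀ a b c d → (a + b) + (c + d) ≈ (a + c) + (b + d)
  +-interchange a b c d = let open ≈-Reasoning in begin
    (a + b) + (c + d) ≈⟨ +-assoc a b (c + d) ⟩
    a + (b + (c + d)) ≈⟨ +-congˡ (sym (+-assoc b c d)) ⟩
    a + ((b + c) + d) ≈⟨ +-congˡ (+-congʳ (+-comm b c)) ⟩
    a + ((c + b) + d) ≈⟨ +-congˡ (+-assoc c b d) ⟩
    a + (c + (b + d)) ≈⟨ sym (+-assoc a c (b + d)) ⟩
    (a + c) + (b + d) ∎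

  _+ₛ_ : Subspace n → Subspace n → Subspace n
  V +ₛ W = record
    { ⟦_⟧     = λ x → ∃ λ v → v ∈ ⟦ V ⟧ × ∃ λ w → w ∈ ⟦ W ⟧ × v +ᵛ w ≋ x
    ; member? = λ x → search
        (λ v≋v′ (v∈V , w , w∈W , e) → resp V v≋v′ v∈V , w , w∈W ,
          ≋-trans (λ i → +-congʳ (sym (v≋v′ i))) e)
        (λ v → member? V v ×-dec search
          (λ w≋w′ (w∈W , e) → resp W w≋w′ w∈W , ≋-trans (λ i → +-congˡ (sym (w≋w′ i))) e)
          (λ w → member? W w ×-dec (v +ᵛ w ≟ᵛ x)))
    ; resp    = λ x≋y (v , v∈V , w , w∈W , e) → v , v∈V , w , w∈W , ≋-trans e x≋y
    ; 0∈      = 0ᵛ , 0∈ V , 0ᵛ , 0∈ W , λ _ → +-identityˡ 0#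
    ; +∈      = λ (v , v∈V , w , w∈W , e) (v′ , v′∈V , w′ , w′∈W , e′) →
        v +ᵛ v′ , +∈ V v∈V v′∈V , w +ᵛ w′ , +∈ W w∈W w′∈W ,
        λ i → trans (+-interchange _ _ _ _) (+-cong (e i) (e′ i))
    ; ·∈      = λ c (v , v∈V , w , w∈W , e) → c · v , ·∈ V c v∈V , c · w , ·∈ W c w∈W ,
        λ i → trans (sym (distribˡ c _ _)) (*-congˡ (e i))
    }

  _∩ₛ_ : Subspace n → Subspace n → Subspace n
  V ∩ₛ W = record
    { ⟦_⟧     = λ x → x ∈ ⟦ V ⟧ × x ∈ ⟦ W ⟧
    ; member? = λ x → member? V x ×-dec member? W x
    ; resp    = λ x≋y (p , r) → resp V x≋y p , resp W x≋y r
    ; 0∈      = 0∈ V , 0∈ W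
    ; +∈      = λ (p , r) (p′ , r′) → +∈ V p p′ , +∈ W r r′
    ; ·∈      = λ c (p , r) → ·∈ V c p , ·∈ W c r
    }

  ∑ₛ : List (Subspace n) → Subspace n
  ∑ₛ = List.foldr _+ₛ_ 𝟎

  -- V ⊕ W, where 𝔽ᵐ⁺ⁿ is identified with 𝔽ᵐ ⊕ 𝔽ⁿ by splitting coordinate vectors.
  infixl 6 _⊕ₛ_

  _⊕ₛ_ : Subspace m → Subspace n → Subspace (m ℕ.+ n)
  _⊕ₛ_ {m = m} {n = n} V W = record
    { ⟦_⟧     = λ x → take m x ∈ ⟦ V ⟧ × drop m x ∈ ⟦ W ⟧
    ; member? = λ x → member? V (take m x) ×-dec member? W (drop m x)
    ; resp    = λ x≋y (p , r) → resp V (x≋y ∘ (_↑ˡ n)) p , resp W (x≋y ∘ (m ↑ʳ_)) r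
    ; 0∈      = 0∈ V , 0∈ W
    ; +∈      = λ (p , r) (p′ , r′) → +∈ V p p′ , +∈ W r r′
    ; ·∈      = λ c (p , r) → ·∈ V c p , ·∈ W c r
    }

  image : (f : Fin m → Fin n) → Subspace n → Subspace m
  image f X = record
    { ⟦_⟧     = λ y → ∃ λ x → x ∈ ⟦ X ⟧ × x ∘ f ≋ y
    ; member? = λ y → search
        (λ x≋x′ (x∈X , e) → resp X x≋x′ x∈X , ≋-trans (≋-sym (x≋x′ ∘ f)) e)
        (λ x → member? X x ×-dec (x ∘ f ≟ᵛ y))
    ; resp    = λ y≋z (x , x∈X , e) → x , x∈X , ≋-trans e y≋z
    ; 0∈      = 0ᵛ , 0∈ X , ≋-refl
    ; +∈      = λ (x , x∈X , e) (x′ , x′∈X , e′) →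
        x +ᵛ x′ , +∈ X x∈X x′∈X , λ i → +-cong (e i) (e′ i)
    ; ·∈      = λ c (x , x∈X , e) → c · x , ·∈ X c x∈X , λ i → *-congˡ (e i)
    }

  -- The images of X under x ↦ take m x and x ↦ drop m x.
  π₁ : ∀ m {n} → Subspace (m ℕ.+ n) → Subspace m
  π₁ m {n} = image (_↑ˡ n)

  π₂ : ∀ m {n} → Subspace (m ℕ.+ n) → Subspace n
  π₂ m = image (m ↑ʳ_)

  -- The field size≤n is redundant; it bounds the enumeration of subspaces below.
  record Basis (V : Subspace n) : Set where
    field
      size        : ℕ
      vector      : Matrix size n
      spanning    : span vector ≐ₛ V
      independent : LinearlyIndependent vector
      size≤n      : size ℕ.≤ n

  ∷-cong : ∀ {x y} {v w : Vec n} → x ≈ y → v ≋ w → (x ∷ v) ≋ (y ∷ w)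
  ∷-cong x≈y v≋w zero    = x≈y
  ∷-cong x≈y v≋w (suc i) = v≋w i

  kernel : Subspace (suc n) → Subspace n
  kernel V = record
    { ⟦_⟧     = λ w → (0# ∷ w) ∈ ⟦ V ⟧
    ; member? = λ w → member? V (0# ∷ w)
    ; resp    = λ w≋w′ → resp V (∷-cong refl w≋w′)
    ; 0∈      = resp V (λ { zero → refl ; (suc _) → refl }) (0∈ V)
    ; +∈      = λ p r → resp V (λ { zero → +-identityˡ 0# ; (suc _) → refl }) (+∈ V p r)
    ; ·∈      = λ c p → resp V (λ { zero → zeroʳ c ; (suc _) → refl }) (·∈ V c p)
    }

  Pivot : Subspace (suc n) → Set
  Pivot V = ∃ λ v → v ∈ ⟦ V ⟧ × ¬ head v ≈ 0#

  pivot? : (V : Subspace (suc n)) → Dec (Pivot V)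
  pivot? V = search
    (λ v≋w (v∈V , v₀≉0) → resp V v≋w v∈V , λ w₀≈0 → v₀≉0 (trans (v≋w zero) w₀≈0))
    (λ v → member? V v ×-dec Dec.¬? (head v ≟ 0#))

  span-least : (V : Subspace n) (Y : Matrix k n) → (∀ i → Y i ∈ ⟦ V ⟧) → span Y ≤ₛ V
  span-least V Y Y∈V x (c , e) = resp V e (lincomb-∈ V c Y Y∈V)

  ∈-span : (Y : Matrix k n) (i : Fin k) → Y i ∈ ⟦ span Y ⟧
  ∈-span Y i = unit i , lincomb-unit i Y

  lift : Matrix k n → Matrix k (suc n)
  lift = Vector.map (0# ∷_)

  lincomb-lift : (c : Vec k) (Y : Matrix k n) → lincomb c (lift Y) ≋ (0# ∷ lincomb c Y)
  lincomb-lift {k = k} c Y zero =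
    trans (sum-cong-≋ λ i → zeroʳ (c i)) (sum-replicate-zero k)
  lincomb-lift c Y (suc j) = refl

  x-y+y : ∀ x y → (x - y) + y ≈ x
  x-y+y x y = trans (+-assoc x (- y) y) (trans (+-congˡ (-‿inverseˡ y)) (+-identityʳ x))

  x+y-x : ∀ x y → (x + y) - x ≈ y
  x+y-x x y = let open ≈-Reasoning in begin
    (x + y) - x   ≈⟨ +-congʳ (+-comm x y) ⟩
    (y + x) - x   ≈⟨ +-assoc y x (- x) ⟩
    y + (x - x)   ≈⟨ +-congˡ (-‿inverseʳ x) ⟩
    y + 0#        ≈⟨ +-identityʳ y ⟩
    y             ∎

  -∈ : (V : Subspace n) {x y : Vec n} → x ∈ ⟦ V ⟧ → y ∈ ⟦ V ⟧ → x -ᵛ y ∈ ⟦ V ⟧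
  -∈ V {y = y} x∈V y∈V =
    resp V (λ i → +-congˡ (-1*x≈-x (y i))) (+∈ V x∈V (·∈ V (- 1#) y∈V))

  cancelʳ : ∀ {x y} → x * y ≈ 0# → ¬ y ≈ 0# → x ≈ 0#
  cancelʳ {x} {y} xy≈0 y≉0 = let y⁻¹ , yy⁻¹≈1 = inverse y y≉0 in let open ≈-Reasoning in begin
    x              ≈⟨ sym (*-identityʳ x) ⟩
    x * 1#         ≈⟨ *-congˡ (sym yy⁻¹≈1) ⟩
    x * (y * y⁻¹)  ≈⟨ sym (*-assoc x y y⁻¹) ⟩
    x * y * y⁻¹    ≈⟨ *-congʳ xy≈0 ⟩
    0# * y⁻¹       ≈⟨ zeroˡ y⁻¹ ⟩
    0#             ∎

  extend : (V : Subspace (suc n)) → Dec (Pivot V) → Basis (kernel V) → Basis V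
  extend V (no ¬pivot) b = record
    { size        = b.size
    ; vector      = lift b.vector
    ; spanning    = span-least V (lift b.vector) (λ i → proj₁ b.spanning _ (∈-span b.vector i))
                  , λ x x∈V → let x₀≈0   = Dec.decidable-stable (head x ≟ 0#) (λ ne → ¬pivot (x , x∈V , ne))
                                  c , e = proj₂ b.spanning (tail x)
                                            (resp V (λ { zero → x₀≈0 ; (suc _) → refl }) x∈V)
                              in c , ≋-trans (lincomb-lift c b.vector)
                                       (λ { zero → sym x₀≈0 ; (suc i) → e i })
    ; independent = λ c e → b.independent c λ i → e (suc i)
    ; size≤n      = ℕ.m≤n⇒m≤1+n b.size≤n
    }
    where module b = Basis b
  extend V (yes (v , v∈V , v₀≉0)) b = record
    { size        = suc b.size
    ; vector      = v ∷ lift b.vector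
    ; spanning    = span-least V (v ∷ lift b.vector)
                      (λ { zero → v∈V ; (suc i) → proj₁ b.spanning _ (∈-span b.vector i) })
                  , λ x x∈V →
                      let v⁻¹ , vv⁻¹≈1 = inverse (head v) v₀≉0
                          a = head x * v⁻¹
                          av₀≈x₀ : a * head v ≈ head x
                          av₀≈x₀ = trans (*-assoc _ _ _) (trans (*-congˡ (trans (*-comm _ _) vv⁻¹≈1)) (*-identityʳ _))
                          y∈V = -∈ V x∈V (·∈ V a v∈V)
                          y₀≈0 : (x -ᵛ a · v) zero ≈ 0#
                          y₀≈0 = trans (+-congˡ (-‿cong av₀≈x₀)) (-‿inverseʳ _)
                          c , e = proj₂ b.spanning (tail (x -ᵛ a · v))
                                    (resp V (λ { zero → y₀≈0 ; (suc _) → refl }) y∈V)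
                      in a ∷ c , λ
                        { zero    → trans (+-cong av₀≈x₀ (lincomb-lift c b.vector zero)) (+-identityʳ _)
                        ; (suc i) → trans (+-congˡ (e i)) (trans (+-comm _ _) (x-y+y _ _)) }
    ; independent = λ c e →
        let c₀≈0 : head c ≈ 0#
            c₀≈0 = cancelʳ (trans (sym (trans (+-congˡ (lincomb-lift (tail c) b.vector zero))
                     (+-identityʳ _))) (e zero)) v₀≉0
        in λ { zero    → c₀≈0
             ; (suc i) → b.independent (tail c) (λ j → trans (sym (trans
                 (+-congʳ (trans (*-congʳ c₀≈0) (zeroˡ _))) (+-identityˡ _))) (e (suc j))) i }
    ; size≤n      = s≤s b.size≤n
    }
    where module b = Basis b

  basis : (V : Subspace n) → Basis V
  basis {n = zero}  V = record
    { size        = zero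
    ; vector      = []
    ; spanning    = (λ x _ → resp V (λ ()) (0∈ V)) , (λ x _ → [] , λ ())
    ; independent = λ _ _ ()
    ; size≤n      = z≤n
    }
  basis {n = suc n} V = extend V (pivot? V) (basis (kernel V))

  dim : Subspace n → ℕ
  dim V = Basis.size (basis V)

  basisMatrix : (V : Subspace n) → Matrix (dim V) n
  basisMatrix V = Basis.vector (basis V)

  rank : Matrix k n → ℕ
  rank A = dim (columnSpace A)

  FullRowRank : Matrix k n → Set
  FullRowRank {k = k} A = rank A ≡ k

  dim-pivot : (V : Subspace (suc n)) → Pivot V → dim V ≡ suc (dim (kernel V))
  dim-pivot V p with pivot? V
  ... | yes _ = ≡.refl
  ... | no ¬p = ⊥-elim (¬p p)

  dim-noPivot : (V : Subspace (suc n)) → ¬ Pivot V → dim V ≡ dim (kernel V)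
  dim-noPivot V ¬p with pivot? V
  ... | yes p = ⊥-elim (¬p p)
  ... | no _  = ≡.refl

  dim-kernel : (V : Subspace (suc n)) → dim (kernel V) ℕ.≤ dim V
  dim-kernel V with pivot? V
  ... | yes _ = ℕ.n≤1+n _
  ... | no _  = ℕ.≤-refl

  independent⇒≤dim : (V : Subspace n) (Y : Matrix k n) → (∀ i → Y i ∈ ⟦ V ⟧) →
                     LinearlyIndependent Y → k ℕ.≤ dim V
  independent⇒≤dim {n = zero} {k = zero}  V Y Y∈V indep = z≤n
  independent⇒≤dim {n = zero} {k = suc k} V Y Y∈V indep =
    ⊥-elim (0≉1 (sym (indep (λ _ → 1#) (λ ()) zero)))
  independent⇒≤dim {n = suc n} {k = k} V Y Y∈V indep
    with Fin.any? (λ i → Dec.¬? (head (Y i) ≟ 0#))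
  ... | no none = ℕ.≤-trans
          (independent⇒≤dim (kernel V) (Vector.map tail Y)
            (λ i → resp V (λ { zero → Y₀≈0 i ; (suc _) → refl }) (Y∈V i))
            (λ c e → indep c λ
              { zero    → trans (sum-cong-≋ λ i → trans (*-congˡ (Y₀≈0 i)) (zeroʳ (c i)))
                            (sum-replicate-zero k)
              ; (suc j) → e j }))
          (dim-kernel V)
    where
    Y₀≈0 : ∀ i → head (Y i) ≈ 0#
    Y₀≈0 i = Dec.decidable-stable (head (Y i) ≟ 0#) (λ ne → none (i , ne))
  independent⇒≤dim {n = suc n} {k = suc k} V Y Y∈V indep | yes (p , Yp₀≉0) =
    ≡.subst (suc k ℕ.≤_) (≡.sym (dim-pivot V (Y p , Y∈V p , Yp₀≉0)))
      (s≤s (independent⇒≤dim (kernel V) (Vector.map tail Z)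
        (λ j → resp V (λ { zero → Z₀≈0 j ; (suc _) → refl }) (Z∈V j))
        Z-indep))
    where
    Yp₀⁻¹ = proj₁ (inverse (head (Y p)) Yp₀≉0)
    f : Vec k
    f j = - (head (Y (punchIn p j)) * Yp₀⁻¹)
    Z : Matrix k (suc n)
    Z j = Y (punchIn p j) +ᵛ f j · Y p
    Z∈V : ∀ j → Z j ∈ ⟦ V ⟧
    Z∈V j = +∈ V (Y∈V (punchIn p j)) (·∈ V (f j) (Y∈V p))
    Z₀≈0 : ∀ j → head (Z j) ≈ 0#
    Z₀≈0 j = let y = head (Y (punchIn p j)) in let open ≈-Reasoning in begin
      y + - (y * Yp₀⁻¹) * head (Y p)
        ≈⟨ +-congˡ (sym (-‿distribˡ-* (y * Yp₀⁻¹) (head (Y p)))) ⟩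
      y - y * Yp₀⁻¹ * head (Y p)
        ≈⟨ +-congˡ (-‿cong (trans (*-assoc _ _ _) (*-congˡ (trans (*-comm _ _)
             (proj₂ (inverse (head (Y p)) Yp₀≉0)))))) ⟩
      y - y * 1#
        ≈⟨ +-congˡ (-‿cong (*-identityʳ y)) ⟩
      y - y
        ≈⟨ -‿inverseʳ y ⟩
      0# ∎
    module _ (c : Vec k) where
      s = ∑[ j < k ] (c j * f j)
      d : Vec (suc k)
      d = Vector.insertAt c p s
      d-Y : lincomb d Y ≋ lincomb c Z
      d-Y h = let open ≈-Reasoning in begin
        ∑[ i < suc k ] (d i * Y i h)
          ≈⟨ sum-remove {i = p} (λ i → d i * Y i h) ⟩
        d p * Y p h + ∑[ j < k ] (d (punchIn p j) * Y (punchIn p j) h)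
          ≈⟨ +-cong (*-congʳ (reflexive (Vector.insertAt-lookup c p s)))
               (sum-cong-≋ λ j → *-congʳ (reflexive (Vector.insertAt-punchIn c p s j))) ⟩
        s * Y p h + ∑[ j < k ] (c j * Y (punchIn p j) h)
          ≈⟨ +-comm _ _ ⟩
        ∑[ j < k ] (c j * Y (punchIn p j) h) + s * Y p h
          ≈⟨ +-congˡ (trans (*-distribʳ-sum (Y p h) (λ j → c j * f j))
               (sum-cong-≋ λ j → *-assoc (c j) (f j) (Y p h))) ⟩
        ∑[ j < k ] (c j * Y (punchIn p j) h) + ∑[ j < k ] (c j * (f j * Y p h))
          ≈⟨ sym (∑-distrib-+ (λ j → c j * Y (punchIn p j) h) (λ j → c j * (f j * Y p h))) ⟩
        ∑[ j < k ] (c j * Y (punchIn p j) h + c j * (f j * Y p h))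
          ≈⟨ sum-cong-≋ (λ j → sym (distribˡ (c j) (Y (punchIn p j) h) (f j * Y p h))) ⟩
        ∑[ j < k ] (c j * Z j h) ∎
    Z-indep : LinearlyIndependent (Vector.map tail Z)
    Z-indep c e j = trans (reflexive (≡.sym (Vector.insertAt-punchIn c p (s c) j)))
      (indep (d c) (≋-trans (d-Y c) λ
        { zero    → trans (sum-cong-≋ λ i → trans (*-congˡ (Z₀≈0 i)) (zeroʳ (c i)))
                      (sum-replicate-zero k)
        ; (suc i) → e i }) (punchIn p j))

  basis∈ : (V : Subspace n) (i : Fin (dim V)) → basisMatrix V i ∈ ⟦ V ⟧
  basis∈ V i = proj₁ (Basis.spanning (basis V)) _ (∈-span (basisMatrix V) i)

  dim-mono : (V W : Subspace n) → V ≤ₛ W → dim V ℕ.≤ dim W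
  dim-mono V W V≤W = independent⇒≤dim W (basisMatrix V)
    (λ i → V≤W _ (basis∈ V i)) (Basis.independent (basis V))

  dim-cong : (V W : Subspace n) → V ≐ₛ W → dim V ≡ dim W
  dim-cong V W (V≤W , W≤V) = ℕ.≤-antisym (dim-mono V W V≤W) (dim-mono W V W≤V)

  dim-span : (Y : Matrix k n) → dim (span Y) ℕ.≤ k
  dim-span {k = k} Y = ℕ.≤-trans
    (independent⇒≤dim (span unit) C (λ i → C i , unit-basis (C i)) C-indep)
    (Basis.size≤n (basis (span unit)))
    where
    B = basisMatrix (span Y)
    C : Matrix (dim (span Y)) k
    C i = proj₁ (basis∈ (span Y) i)
    unit-sym : ∀ {k} (i j : Fin k) → unit i j ≈ unit j i
    unit-sym zero    zero    = refl
    unit-sym zero    (suc j) = refl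
    unit-sym (suc i) zero    = refl
    unit-sym (suc i) (suc j) = unit-sym i j
    unit-basis : ∀ {k} (c : Vec k) → lincomb c unit ≋ c
    unit-basis c j = trans (sum-cong-≋ λ i → trans (*-comm _ _) (*-congʳ (unit-sym i j)))
      (lincomb-unit j (λ i (_ : Fin 1) → c i) zero)
    C-indep : LinearlyIndependent C
    C-indep c e = Basis.independent (basis (span Y)) c
      (≋-trans (lincomb-cong {c = c} ≋-refl (λ i → ≋-sym (proj₂ (basis∈ (span Y) i))))
        (≋-trans (lincomb-assoc c C Y) (≋-trans (lincomb-cong e (λ _ → ≋-refl)) (lincomb-0 Y))))

  𝟏 : Subspace n
  𝟏 = record
    { ⟦_⟧ = λ _ → ⊤ ; member? = λ _ → yes _ ; resp = _ ; 0∈ = _ ; +∈ = _ ; ·∈ = _ }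

  -- The kernel of π₁ restricted to U, viewed in the second summand.
  fibre : ∀ m {n} → Subspace (m ℕ.+ n) → Subspace n
  fibre m {n} U = π₂ m (U ∩ₛ (𝟎 {m} ⊕ₛ 𝟏 {n}))

  dim-π₁+fibre : ∀ m {n} (U : Subspace (m ℕ.+ n)) → dim U ≡ dim (π₁ m U) ℕ.+ dim (fibre m U)
  dim-π₁+fibre zero U = dim-cong U (fibre zero U)
    ( (λ x x∈U → x , (x∈U , (λ ()) , _) , ≋-refl)
    , (λ x (x′ , (x′∈U , _) , e) → resp U e x′∈U))
  dim-π₁+fibre (suc m) {n} U = go (pivot? U)
    where
    open ≡.≡-Reasoning
    π-kernel : π₁ m (kernel U) ≐ₛ kernel (π₁ (suc m) U)
    π-kernel = (λ y (x , x∈ , e) → 0# ∷ x , x∈ , λ { zero → refl ; (suc i) → e i })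
             , (λ y (x , x∈ , e) → tail x ,
                  resp U (λ { zero → e zero ; (suc i) → refl }) x∈ , e ∘ suc)
    fibre-kernel : fibre m (kernel U) ≐ₛ fibre (suc m) U
    fibre-kernel =
        (λ w (x , (x∈ , x₁≋0 , _) , e) →
          0# ∷ x , (x∈ , (λ { zero → refl ; (suc i) → x₁≋0 i }) , _) , e)
      , (λ w (x , (x∈ , x₁≋0 , _) , e) →
          tail x , (resp U (λ { zero → x₁≋0 zero ; (suc i) → refl }) x∈ , x₁≋0 ∘ suc , _) , e)
    kernels : dim (kernel U) ≡ dim (kernel (π₁ (suc m) U)) ℕ.+ dim (fibre (suc m) U)
    kernels = ≡.trans (dim-π₁+fibre m (kernel U))
      (≡.cong₂ ℕ._+_ (dim-cong _ _ π-kernel) (dim-cong _ _ fibre-kernel))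
    go : Dec (Pivot U) → dim U ≡ dim (π₁ (suc m) U) ℕ.+ dim (fibre (suc m) U)
    go (yes p@(x , x∈U , x₀≉0)) = begin
      dim U                   ≡⟨ dim-pivot U p ⟩
      suc (dim (kernel U))    ≡⟨ ≡.cong suc kernels ⟩
      suc (dim (kernel (π₁ (suc m) U))) ℕ.+ dim (fibre (suc m) U)
        ≡⟨ ≡.cong (ℕ._+ dim (fibre (suc m) U)) (≡.sym (dim-pivot (π₁ (suc m) U)
             (take (suc m) x , (x , x∈U , ≋-refl) , x₀≉0))) ⟩
      dim (π₁ (suc m) U) ℕ.+ dim (fibre (suc m) U) ∎
    go (no ¬p) = begin
      dim U                   ≡⟨ dim-noPivot U ¬p ⟩
      dim (kernel U)          ≡⟨ kernels ⟩
      dim (kernel (π₁ (suc m) U)) ℕ.+ dim (fibre (suc m) U)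
        ≡⟨ ≡.cong (ℕ._+ dim (fibre (suc m) U)) (≡.sym (dim-noPivot (π₁ (suc m) U)
             λ (y , (x , x∈U , e) , y₀≉0) → ¬p (x , x∈U , λ x₀≈0 → y₀≉0 (trans (sym (e zero)) x₀≈0)))) ⟩
      dim (π₁ (suc m) U) ℕ.+ dim (fibre (suc m) U) ∎

  preimage : (f : Fin n → Fin m) → Subspace n → Subspace m
  preimage f U = record
    { ⟦_⟧     = λ x → x ∘ f ∈ ⟦ U ⟧
    ; member? = λ x → member? U (x ∘ f)
    ; resp    = λ x≋y → resp U (x≋y ∘ f)
    ; 0∈      = 0∈ U
    ; +∈      = λ p r → +∈ U p r
    ; ·∈      = λ c p → ·∈ U c p
    }

  -- Rearranging coordinates along a surjection is injective.
  dim-rearrange : (f : Fin n → Fin m) → (∀ j → ∃ λ i → f i ≡ j) →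
                  (U : Subspace m) (W : Subspace n) →
                  (∀ x → x ∈ ⟦ U ⟧ → x ∘ f ∈ ⟦ W ⟧) → dim U ℕ.≤ dim W
  dim-rearrange f surj U W U→W = independent⇒≤dim W (λ i → basisMatrix U i ∘ f)
    (λ i → U→W _ (basis∈ U i))
    (λ c e → Basis.independent (basis U) c λ j → let i , fi≡j = surj j in
      ≡.subst (λ j → lincomb c (basisMatrix U) j ≈ 0#) fi≡j (e i))

  module _ (n : ℕ) where
    exchange : Fin (n ℕ.+ n) → Fin (n ℕ.+ n)
    exchange = join n n ∘ Sum.swap ∘ splitAt n

    exchange-ˡ : ∀ i → exchange (i ↑ˡ n) ≡ n ↑ʳ i
    exchange-ˡ i = ≡.cong (join n n ∘ Sum.swap) (Fin.splitAt-↑ˡ n i n)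

    exchange-ʳ : ∀ i → exchange (n ↑ʳ i) ≡ i ↑ˡ n
    exchange-ʳ i = ≡.cong (join n n ∘ Sum.swap) (Fin.splitAt-↑ʳ n n i)

    exchange-involutive : ∀ j → exchange (exchange j) ≡ j
    exchange-involutive j = go (splitAt n j) (Fin.join-splitAt n n j)
      where
      go : ∀ s → join n n s ≡ j → exchange (exchange j) ≡ j
      go (inj₁ i) ≡.refl = ≡.trans (≡.cong exchange (exchange-ˡ i)) (exchange-ʳ i)
      go (inj₂ i) ≡.refl = ≡.trans (≡.cong exchange (exchange-ʳ i)) (exchange-ˡ i)

  dim-modular : (V W : Subspace n) → dim (V +ₛ W) ℕ.+ dim (V ∩ₛ W) ≡ dim V ℕ.+ dim W
  dim-modular {n = n} V W = begin
    dim (V +ₛ W) ℕ.+ dim (V ∩ₛ W)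
      ≡⟨ ≡.cong₂ ℕ._+_ (dim-cong _ _ sum≐) (dim-cong _ _ meet≐) ⟩
    dim (π₁ n U) ℕ.+ dim (fibre n U)
      ≡⟨ ≡.sym (dim-π₁+fibre n U) ⟩
    dim U
      ≡⟨ ℕ.≤-antisym
           (dim-rearrange (exchange n) (λ j → (exchange n) j , exchange-involutive n j) U U′
             λ x x∈U → resp U (λ i → reflexive (≡.cong x (≡.sym (exchange-involutive n i)))) x∈U)
           (dim-rearrange (exchange n) (λ j → (exchange n) j , exchange-involutive n j) U′ U
             λ x x∈U′ → x∈U′) ⟩
    dim U′
      ≡⟨ dim-π₁+fibre n U′ ⟩
    dim (π₁ n U′) ℕ.+ dim (fibre n U′)
      ≡⟨ ≡.cong₂ ℕ._+_ (dim-cong _ _ first≐) (dim-cong _ _ second≐) ⟩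
    dim V ℕ.+ dim W ∎
    where
    open ≡.≡-Reasoning
    -- U = { (x , y) ∣ y ∈ V , x - y ∈ W }, and U′ is U with the two blocks exchanged.
    U U′ : Subspace (n ℕ.+ n)
    U = record
      { ⟦_⟧     = λ z → drop n z ∈ ⟦ V ⟧ × take n z -ᵛ drop n z ∈ ⟦ W ⟧
      ; member? = λ z → member? V (drop n z) ×-dec member? W (take n z -ᵛ drop n z)
      ; resp    = λ z≋z′ (p , r) → resp V (z≋z′ ∘ (n ↑ʳ_)) p
                    , resp W (λ i → +-cong (z≋z′ (i ↑ˡ n)) (-‿cong (z≋z′ (n ↑ʳ i)))) r
      ; 0∈      = 0∈ V , resp W (λ _ → sym (-‿inverseʳ 0#)) (0∈ W)
      ; +∈      = λ (p , r) (p′ , r′) → +∈ V p p′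
                    , resp W (λ i → trans (+-interchange _ _ _ _) (+-congˡ (-‿+-comm _ _))) (+∈ W r r′)
      ; ·∈      = λ c (p , r) → ·∈ V c p
                    , resp W (λ i → trans (distribˡ c _ _) (+-congˡ (sym (-‿distribʳ-* c _)))) (·∈ W c r)
      }
    U′ = preimage (exchange n) U
    pair : Vec n → Vec n → Vec (n ℕ.+ n)
    pair x y = x ++ y
    pairˡ : ∀ x y → take n (pair x y) ≋ x
    pairˡ x y i = reflexive (Vector.lookup-++ˡ x y i)
    pairʳ : ∀ x y → drop n (pair x y) ≋ y
    pairʳ x y i = reflexive (Vector.lookup-++ʳ x y i)
    ∈U : ∀ x y → y ∈ ⟦ V ⟧ → x -ᵛ y ∈ ⟦ W ⟧ → pair x y ∈ ⟦ U ⟧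
    ∈U x y y∈V x-y∈W = resp V (≋-sym (pairʳ x y)) y∈V
      , resp W (λ i → +-cong (sym (pairˡ x y i)) (-‿cong (sym (pairʳ x y i)))) x-y∈W
    -- U′ = { (y , x) ∣ y ∈ V , x - y ∈ W }
    ∈U′ : ∀ x y → y ∈ ⟦ V ⟧ → x -ᵛ y ∈ ⟦ W ⟧ → pair y x ∈ ⟦ U′ ⟧
    ∈U′ x y y∈V x-y∈W =
        resp V (λ i → sym (at-ʳ i)) y∈V
      , resp W (λ i → +-cong (sym (at-ˡ i)) (-‿cong (sym (at-ʳ i)))) x-y∈W
      where
      at-ʳ : ∀ i → pair y x ((exchange n) (n ↑ʳ i)) ≈ y i
      at-ʳ i = trans (reflexive (≡.cong (pair y x) (exchange-ʳ n i))) (pairˡ y x i)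
      at-ˡ : ∀ i → pair y x ((exchange n) (i ↑ˡ n)) ≈ x i
      at-ˡ i = trans (reflexive (≡.cong (pair y x) (exchange-ˡ n i))) (pairʳ y x i)
    U′∈ : ∀ z → z ∈ ⟦ U′ ⟧ → take n z ∈ ⟦ V ⟧ × drop n z -ᵛ take n z ∈ ⟦ W ⟧
    U′∈ z (p , r) =
        resp V (λ i → reflexive (≡.cong z (exchange-ʳ n i))) p
      , resp W (λ i → reflexive (≡.cong₂ (λ a b → z a - z b) (exchange-ˡ n i) (exchange-ʳ n i))) r
    x-0 : ∀ x → x - 0# ≈ x
    x-0 x = trans (+-congˡ -0#≈0#) (+-identityʳ x)
    sum≐ : V +ₛ W ≐ₛ π₁ n U
    sum≐ = (λ x (v , v∈V , w , w∈W , e) → pair x v ,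
              ∈U x v v∈V (resp W (λ i → trans (sym (x+y-x (v i) (w i))) (+-congʳ (e i))) w∈W) ,
              pairˡ x v)
         , (λ x (z , (p , r) , e) → drop n z , p , take n z -ᵛ drop n z , r ,
              λ i → trans (+-comm _ _) (trans (x-y+y _ _) (e i)))
    meet≐ : V ∩ₛ W ≐ₛ fibre n U
    meet≐ = (λ y (y∈V , y∈W) → pair 0ᵛ y ,
               (∈U 0ᵛ y y∈V (resp W (λ i → trans (-1*x≈-x (y i)) (sym (+-identityˡ _))) (·∈ W (- 1#) y∈W)) ,
                pairˡ 0ᵛ y , _) , pairʳ 0ᵛ y)
          , (λ y (z , ((p , r) , z₁≋0 , _) , e) → resp V e p ,
               resp W (λ i → trans (-1*x≈-x _) (trans (-‿cong (trans (+-cong (z₁≋0 i) (-‿cong (e i)))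
                 (+-identityˡ _))) (-‿involutive (y i)))) (·∈ W (- 1#) r))
    first≐ : π₁ n U′ ≐ₛ V
    first≐ = (λ y (z , z∈ , e) → resp V e (proj₁ (U′∈ z z∈)))
           , (λ y y∈V → pair y y ,
                ∈U′ y y y∈V (resp W (λ i → sym (-‿inverseʳ (y i))) (0∈ W)) , pairˡ y y)
    second≐ : fibre n U′ ≐ₛ W
    second≐ = (λ x (z , (z∈ , z₁≋0 , _) , e) →
                 resp W (λ i → trans (+-cong (e i) (-‿cong (z₁≋0 i))) (x-0 (x i))) (proj₂ (U′∈ z z∈)))
            , (λ x x∈W → pair 0ᵛ x ,
                 (∈U′ x 0ᵛ (0∈ V) (resp W (λ i → sym (x-0 (x i))) x∈W) , pairˡ 0ᵛ x , _) , pairʳ 0ᵛ x)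

  dim-≤𝟎 : (V : Subspace n) → V ≤ₛ 𝟎 → dim V ≡ 0
  dim-≤𝟎 {n = n} V V≤𝟎 = ℕ.n≤0⇒n≡0 (ℕ.≤-trans
    (dim-mono V (span ∅) λ x x∈V → [] , ≋-sym (V≤𝟎 x x∈V)) (dim-span ∅))
    where
    ∅ : Matrix 0 n
    ∅ ()

  infix 4 _≤ₛ?_

  _≤ₛ?_ : (V W : Subspace n) → Dec (V ≤ₛ W)
  V ≤ₛ? W = Dec.map′
    (λ B∈W x x∈V → span-least W (basisMatrix V) B∈W x (proj₂ (Basis.spanning (basis V)) x x∈V))
    (λ V≤W i → V≤W _ (basis∈ V i))
    (Fin.all? λ i → member? W (basisMatrix V i))

  subspaces : ∀ n → List (Subspace n)
  subspaces n = List.concatMap (λ k → List.map rowSpace (matrices k n)) (List.upTo (suc n))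

  subspacesOf : Subspace n → List (Subspace n)
  subspacesOf V = List.filter (_≤ₛ? V) (subspaces _)

  subspaces-complete : (X : Subspace n) → Any (X ≐ₛ_) (subspaces n)
  subspaces-complete {n = n} X =
    Any.concatMap⁺ (λ k → List.map rowSpace (matrices k n))
    (Any.map (λ { ≡.refl → Any.map⁺ (Any.map equal (matrices-complete (basisMatrix X))) })
      (∈-upTo⁺ (s≤s (Basis.size≤n (basis X)))))
    where
    equal : {Z : Matrix (dim X) n} → (∀ i → basisMatrix X i ≋ Z i) → X ≐ₛ span Z
    equal {Z} B≋Z =
        (λ x x∈X → let c , e = proj₂ (Basis.spanning (basis X)) x x∈X in
          c , ≋-trans (lincomb-cong {c = c} ≋-refl (λ i → ≋-sym (B≋Z i))) e)
      , span-least X Z (λ i → resp X (B≋Z i) (basis∈ X i))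

  subspacesOf-complete : (V X : Subspace n) → X ≤ₛ V → Any (X ≐ₛ_) (subspacesOf V)
  subspacesOf-complete V X X≤V with find (subspaces-complete X)
  ... | Z , Z∈ , X≐Z = lose
    (∈-filter⁺ (_≤ₛ? V) Z∈ (λ x x∈Z → X≤V x (proj₂ X≐Z x x∈Z))) X≐Z

  subspacesOf-sound : (V : Subspace n) → All (_≤ₛ V) (subspacesOf V)
  subspacesOf-sound {n = n} V = All.all-filter (_≤ₛ? V) (subspaces n)

module QMatroids {q : ℕ} (𝔽 : FiniteField q) where
  open LinearAlgebra 𝔽

  -- Since the ground space may be taken to be 𝔽ⁿ, a q-matroid is given by its rank function.
  record QMatroid (n : ℕ) : Set₁ where
    field
      ρ          : Subspace n → ℕ
      ρ≤dim      : ∀ V → ρ V ℕ.≤ dim V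
      monotone   : ∀ V W → V ≤ₛ W → ρ V ℕ.≤ ρ W
      submodular : ∀ V W → ρ (V +ₛ W) ℕ.+ ρ (V ∩ₛ W) ℕ.≤ ρ V ℕ.+ ρ W

  module _ (M : QMatroid n) where
    open QMatroid M

    IsIndependent : Pred (Subspace n) 0ℓ
    IsIndependent V = ρ V ≡ dim V

    IsDependent : Pred (Subspace n) 0ℓ
    IsDependent V = ¬ IsIndependent V

    IsCircuit : Subspace n → Set₁
    IsCircuit C = IsDependent C × (∀ D → D ≤ₛ C → ¬ C ≤ₛ D → IsIndependent D)

    IsOpen : Subspace n → Set₁
    IsOpen O = ∃ λ Cs → All IsCircuit Cs × O ≐ₛ ∑ₛ Cs

    IsFlat : Pred (Subspace n) 0ℓ
    IsFlat F = ∀ x → x ∉ ⟦ F ⟧ → ρ F ℕ.< ρ (F +ₛ ⟨ x ⟩)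

    cyc : Subspace n → Vec n → Set₁
    cyc V x = x ∈ ⟦ V ⟧ × (∀ W → W ≤ₛ V → W +ₛ ⟨ x ⟩ ≐ₛ V → ρ W ≡ ρ V)

    IsCyclic : Subspace n → Set₁
    IsCyclic V = cyc V ≐ ⟦ V ⟧

    𝒵 : Subspace n → Set₁
    𝒵 V = IsFlat V × IsCyclic V

  module DirectSum {m n : ℕ} (M₁ : QMatroid m) (M₂ : QMatroid n) where
    private
      module M₁ = QMatroid M₁
      module M₂ = QMatroid M₂

    φ : Subspace (m ℕ.+ n) → ℕ
    φ X = M₁.ρ (π₁ m X) ℕ.+ M₂.ρ (π₂ m X)

    -- dim V + (φ X - dim X); the truncated subtraction is exact whenever X ≤ₛ V.
    value : Subspace (m ℕ.+ n) → Subspace (m ℕ.+ n) → ℕ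
    value V X = (dim V ℕ.+ φ X) ℕ.∸ dim X

    minimiser : Subspace (m ℕ.+ n) → Subspace (m ℕ.+ n)
    minimiser V = Extrema.argmin (value V) 𝟎 (subspacesOf V)

    ρ⊕ : Subspace (m ℕ.+ n) → ℕ
    ρ⊕ V = value V (minimiser V)

    image-mono : ∀ {k l} (f : Fin k → Fin l) (X Y : Subspace l) → X ≤ₛ Y → image f X ≤ₛ image f Y
    image-mono f X Y X≤Y y (x , x∈X , e) = x , X≤Y x x∈X , e

    φ-mono : ∀ X Y → X ≤ₛ Y → φ X ℕ.≤ φ Y
    φ-mono X Y X≤Y = ℕ.+-mono-≤
      (M₁.monotone (π₁ m X) (π₁ m Y) (image-mono (_↑ˡ n) X Y X≤Y))
      (M₂.monotone (π₂ m X) (π₂ m Y) (image-mono (m ↑ʳ_) X Y X≤Y))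

    φ-submodular : ∀ X Y → φ (X +ₛ Y) ℕ.+ φ (X ∩ₛ Y) ℕ.≤ φ X ℕ.+ φ Y
    φ-submodular X Y = ≡.subst₂ ℕ._≤_
      (ℕ-interchange (M₁.ρ (π₁ m (X +ₛ Y))) (M₁.ρ (π₁ m (X ∩ₛ Y))) _ _)
      (ℕ-interchange (M₁.ρ (π₁ m X)) (M₁.ρ (π₁ m Y)) _ _)
      (ℕ.+-mono-≤ (via M₁ (_↑ˡ n)) (via M₂ (m ↑ʳ_)))
      where
      ℕ-interchange : ∀ a b c d → (a ℕ.+ b) ℕ.+ (c ℕ.+ d) ≡ (a ℕ.+ c) ℕ.+ (b ℕ.+ d)
      ℕ-interchange = solve-∀
      via : ∀ {l} (M : QMatroid l) (f : Fin l → Fin (m ℕ.+ n)) → let open QMatroid M in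
            ρ (image f (X +ₛ Y)) ℕ.+ ρ (image f (X ∩ₛ Y)) ℕ.≤ ρ (image f X) ℕ.+ ρ (image f Y)
      via M f = ℕ.≤-trans
        (ℕ.+-mono-≤
          (monotone (image f (X +ₛ Y)) (image f X +ₛ image f Y)
            λ z (x+y , (x , x∈X , y , y∈Y , e) , e′) →
              x ∘ f , (x , x∈X , ≋-refl) , y ∘ f , (y , y∈Y , ≋-refl) , ≋-trans (e ∘ f) e′)
          (monotone (image f (X ∩ₛ Y)) (image f X ∩ₛ image f Y)
            λ z (x , (x∈X , x∈Y) , e) → (x , x∈X , e) , (x , x∈Y , e)))
        (submodular (image f X) (image f Y))
        where open QMatroid M

    minimiser-≤ : ∀ V → minimiser V ≤ₛ V
    minimiser-≤ V = Extrema.argmin-all (value V)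
      (λ x x≋0 → resp V (≋-sym x≋0) (0∈ V)) (subspacesOf-sound V)

    value-exact : ∀ V X → X ≤ₛ V → value V X ℕ.+ dim X ≡ dim V ℕ.+ φ X
    value-exact V X X≤V = ℕ.m∸n+n≡m (ℕ.≤-trans (dim-mono X V X≤V) (ℕ.m≤m+n _ _))

    ρ⊕-attained : ∀ V → ρ⊕ V ℕ.+ dim (minimiser V) ≡ dim V ℕ.+ φ (minimiser V)
    ρ⊕-attained V = value-exact V (minimiser V) (minimiser-≤ V)

    ρ⊕-minimal : ∀ V X → X ≤ₛ V → ρ⊕ V ℕ.+ dim X ℕ.≤ dim V ℕ.+ φ X
    ρ⊕-minimal V X X≤V with find (subspacesOf-complete V X X≤V)
    ... | Z , Z∈ , (X≤Z , Z≤X) = ≡.subst (ρ⊕ V ℕ.+ dim X ℕ.≤_) (value-exact V X X≤V)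
      (ℕ.+-monoˡ-≤ (dim X) (≡.subst (ρ⊕ V ℕ.≤_) value-cong
        (All.lookup (Extrema.f[argmin]≤f[xs] {f = value V} 𝟎 (subspacesOf V)) Z∈)))
      where
      value-cong : value V Z ≡ value V X
      value-cong = ≡.cong₂ (λ a b → (dim V ℕ.+ a) ℕ.∸ b)
        (ℕ.≤-antisym (φ-mono Z X Z≤X) (φ-mono X Z X≤Z)) (dim-cong Z X (Z≤X , X≤Z))

    ρ⊕≤dim : ∀ V → ρ⊕ V ℕ.≤ dim V
    ρ⊕≤dim V = begin
      ρ⊕ V                     ≤⟨ ℕ.m≤m+n _ _ ⟩
      ρ⊕ V ℕ.+ dim O           ≤⟨ ρ⊕-minimal V O (λ x x≋0 → resp V (≋-sym x≋0) (0∈ V)) ⟩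
      dim V ℕ.+ φ O            ≤⟨ ℕ.+-monoʳ-≤ (dim V) (ℕ.+-mono-≤ (M₁.ρ≤dim (π₁ m O)) (M₂.ρ≤dim (π₂ m O))) ⟩
      dim V ℕ.+ (dim (π₁ m O) ℕ.+ dim (π₂ m O))
        ≡⟨ ≡.cong (dim V ℕ.+_) (≡.cong₂ ℕ._+_ (dim-image (_↑ˡ n)) (dim-image (m ↑ʳ_))) ⟩
      dim V ℕ.+ 0              ≡⟨ ℕ.+-identityʳ _ ⟩
      dim V                    ∎
      where
      open ℕ.≤-Reasoning
      O = 𝟎 {m ℕ.+ n}
      dim-image : ∀ {l} (f : Fin l → Fin (m ℕ.+ n)) → dim (image f O) ≡ 0
      dim-image f = dim-≤𝟎 (image f O) λ y (x , x≋0 , e) → ≋-trans (≋-sym e) (x≋0 ∘ f)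

    ρ⊕-monotone : ∀ V W → V ≤ₛ W → ρ⊕ V ℕ.≤ ρ⊕ W
    ρ⊕-monotone V W V≤W = ℕ.+-cancelʳ-≤ (dim (V ∩ₛ X) ℕ.+ dim X) _ _ (begin
      ρ⊕ V ℕ.+ (dim (V ∩ₛ X) ℕ.+ dim X)
        ≡⟨ ≡.sym (ℕ.+-assoc (ρ⊕ V) _ _) ⟩
      ρ⊕ V ℕ.+ dim (V ∩ₛ X) ℕ.+ dim X
        ≤⟨ ℕ.+-monoˡ-≤ (dim X) (ρ⊕-minimal V (V ∩ₛ X) (λ _ → proj₁)) ⟩
      dim V ℕ.+ φ (V ∩ₛ X) ℕ.+ dim X
        ≤⟨ ℕ.+-monoˡ-≤ (dim X) (ℕ.+-monoʳ-≤ (dim V) (φ-mono (V ∩ₛ X) X (λ _ → proj₂))) ⟩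
      dim V ℕ.+ φ X ℕ.+ dim X
        ≡⟨ swap₁ (dim V) (φ X) (dim X) ⟩
      dim V ℕ.+ dim X ℕ.+ φ X
        ≡⟨ ≡.cong (ℕ._+ φ X) (≡.sym (dim-modular V X)) ⟩
      dim (V +ₛ X) ℕ.+ dim (V ∩ₛ X) ℕ.+ φ X
        ≤⟨ ℕ.+-monoˡ-≤ (φ X) (ℕ.+-monoˡ-≤ (dim (V ∩ₛ X)) (dim-mono (V +ₛ X) W sum≤W)) ⟩
      dim W ℕ.+ dim (V ∩ₛ X) ℕ.+ φ X
        ≡⟨ swap₁ (dim W) (dim (V ∩ₛ X)) (φ X) ⟩
      dim W ℕ.+ φ X ℕ.+ dim (V ∩ₛ X)
        ≡⟨ ≡.cong (ℕ._+ dim (V ∩ₛ X)) (≡.sym (ρ⊕-attained W)) ⟩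
      ρ⊕ W ℕ.+ dim X ℕ.+ dim (V ∩ₛ X)
        ≡⟨ swap₂ (ρ⊕ W) (dim X) (dim (V ∩ₛ X)) ⟩
      ρ⊕ W ℕ.+ (dim (V ∩ₛ X) ℕ.+ dim X) ∎)
      where
      open ℕ.≤-Reasoning
      X = minimiser W
      swap₁ : ∀ a b c → a ℕ.+ b ℕ.+ c ≡ a ℕ.+ c ℕ.+ b
      swap₁ = solve-∀
      swap₂ : ∀ a b c → a ℕ.+ b ℕ.+ c ≡ a ℕ.+ (c ℕ.+ b)
      swap₂ = solve-∀
      sum≤W : V +ₛ X ≤ₛ W
      sum≤W x (v , v∈V , w , w∈X , e) = resp W e (+∈ W (V≤W v v∈V) (minimiser-≤ W w w∈X))

    ρ⊕-submodular : ∀ V W → ρ⊕ (V +ₛ W) ℕ.+ ρ⊕ (V ∩ₛ W) ℕ.≤ ρ⊕ V ℕ.+ ρ⊕ W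
    ρ⊕-submodular V W = ℕ.+-cancelʳ-≤ (dim X ℕ.+ dim Y) _ _ (begin
      ρ⊕ (V +ₛ W) ℕ.+ ρ⊕ (V ∩ₛ W) ℕ.+ (dim X ℕ.+ dim Y)
        ≡⟨ ≡.cong (ρ⊕ (V +ₛ W) ℕ.+ ρ⊕ (V ∩ₛ W) ℕ.+_) (≡.sym (dim-modular X Y)) ⟩
      ρ⊕ (V +ₛ W) ℕ.+ ρ⊕ (V ∩ₛ W) ℕ.+ (dim (X +ₛ Y) ℕ.+ dim (X ∩ₛ Y))
        ≡⟨ swap (ρ⊕ (V +ₛ W)) (ρ⊕ (V ∩ₛ W)) (dim (X +ₛ Y)) (dim (X ∩ₛ Y)) ⟩
      ρ⊕ (V +ₛ W) ℕ.+ dim (X +ₛ Y) ℕ.+ (ρ⊕ (V ∩ₛ W) ℕ.+ dim (X ∩ₛ Y))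
        ≤⟨ ℕ.+-mono-≤ (ρ⊕-minimal (V +ₛ W) (X +ₛ Y) sum≤) (ρ⊕-minimal (V ∩ₛ W) (X ∩ₛ Y) meet≤) ⟩
      dim (V +ₛ W) ℕ.+ φ (X +ₛ Y) ℕ.+ (dim (V ∩ₛ W) ℕ.+ φ (X ∩ₛ Y))
        ≡⟨ swap (dim (V +ₛ W)) (φ (X +ₛ Y)) (dim (V ∩ₛ W)) (φ (X ∩ₛ Y)) ⟩
      dim (V +ₛ W) ℕ.+ dim (V ∩ₛ W) ℕ.+ (φ (X +ₛ Y) ℕ.+ φ (X ∩ₛ Y))
        ≤⟨ ℕ.+-mono-≤ (ℕ.≤-reflexive (dim-modular V W)) (φ-submodular X Y) ⟩
      dim V ℕ.+ dim W ℕ.+ (φ X ℕ.+ φ Y)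
        ≡⟨ swap (dim V) (dim W) (φ X) (φ Y) ⟩
      dim V ℕ.+ φ X ℕ.+ (dim W ℕ.+ φ Y)
        ≡⟨ ≡.sym (≡.cong₂ ℕ._+_ (ρ⊕-attained V) (ρ⊕-attained W)) ⟩
      ρ⊕ V ℕ.+ dim X ℕ.+ (ρ⊕ W ℕ.+ dim Y)
        ≡⟨ swap (ρ⊕ V) (dim X) (ρ⊕ W) (dim Y) ⟩
      ρ⊕ V ℕ.+ ρ⊕ W ℕ.+ (dim X ℕ.+ dim Y) ∎)
      where
      open ℕ.≤-Reasoning
      X = minimiser V
      Y = minimiser W
      swap : ∀ a b c d → a ℕ.+ b ℕ.+ (c ℕ.+ d) ≡ a ℕ.+ c ℕ.+ (b ℕ.+ d)
      swap = solve-∀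
      sum≤ : X +ₛ Y ≤ₛ V +ₛ W
      sum≤ z (x , x∈X , y , y∈Y , e) = x , minimiser-≤ V x x∈X , y , minimiser-≤ W y y∈Y , e
      meet≤ : X ∩ₛ Y ≤ₛ V ∩ₛ W
      meet≤ z (z∈X , z∈Y) = minimiser-≤ V z z∈X , minimiser-≤ W z z∈Y

  infixl 6 _⊕_

  _⊕_ : QMatroid m → QMatroid n → QMatroid (m ℕ.+ n)
  M₁ ⊕ M₂ = record
    { ρ = ρ⊕ ; ρ≤dim = ρ⊕≤dim ; monotone = ρ⊕-monotone ; submodular = ρ⊕-submodular }
    where open DirectSum M₁ M₂

module Representation {q r : ℕ} {𝔽 : FiniteField q} {𝕂 : FiniteField r}
                      (𝕂/𝔽 : FieldExtension 𝔽 𝕂) where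
  open FieldExtension 𝕂/𝔽
  open IsRingHomomorphism isRingHomomorphism using (⟦⟧-cong; +-homo; *-homo; 0#-homo)
  private
    module F = LinearAlgebra 𝔽
    module K = LinearAlgebra 𝕂
  open F using (_≤ₛ_; _≐ₛ_; _+ₛ_; _∩ₛ_; ⟦_⟧)
  open K using (_≈_; _≋_; sum-syntax)
  open QMatroids 𝔽 using (QMatroid)

  embedMatrix : F.Matrix k n → K.Matrix k n
  embedMatrix = Vector.map (Vector.map embed)

  embed-sum : (f : F.Vec k) → embed (F.sum f) ≈ K.sum (embed ∘ f)
  embed-sum {k = zero}  f = 0#-homo
  embed-sum {k = suc k} f = K.trans (+-homo _ _) (K.+-congˡ (embed-sum (f ∘ suc)))

  module _ {k n : ℕ} (G : K.Matrix k n) where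
    act : F.Vec n → K.Vec k
    act v i = ∑[ h < n ] (G i h K.* embed (v h))

    act-cong : ∀ {v w} → v F.≋ w → act v ≋ act w
    act-cong v≋w i = K.sum-cong-≋ λ h → K.*-congˡ (⟦⟧-cong (v≋w h))

    act-+ : ∀ v w → act (v F.+ᵛ w) ≋ act v K.+ᵛ act w
    act-+ v w i = K.trans
      (K.sum-cong-≋ {n} λ h → K.trans (K.*-congˡ (+-homo (v h) (w h)))
        (K.distribˡ (G i h) (embed (v h)) (embed (w h))))
      (K.∑-distrib-+ (λ h → G i h K.* embed (v h)) (λ h → G i h K.* embed (w h)))

    act-lincomb : (c : F.Vec l) (Y : F.Matrix l n) →
                  act (F.lincomb c Y) ≋ K.lincomb (embed ∘ c) (act ∘ Y)
    act-lincomb {l = l} c Y i = begin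
      ∑[ h < n ] (G i h K.* embed (F.sum λ j → c j F.* Y j h))
        ≈⟨ K.sum-cong-≋ (λ h → K.trans
             (K.*-congˡ (K.trans (embed-sum λ j → c j F.* Y j h) (K.sum-cong-≋ λ j → *-homo (c j) (Y j h))))
             (K.*-distribˡ-sum (G i h) λ j → embed (c j) K.* embed (Y j h))) ⟩
      ∑[ h < n ] ∑[ j < l ] (G i h K.* (embed (c j) K.* embed (Y j h)))
        ≈⟨ K.∑-comm (λ h j → G i h K.* (embed (c j) K.* embed (Y j h))) ⟩
      ∑[ j < l ] ∑[ h < n ] (G i h K.* (embed (c j) K.* embed (Y j h)))
        ≈⟨ K.sum-cong-≋ (λ j → K.trans
             (K.sum-cong-≋ λ h → rearrange (G i h) (embed (c j)) (embed (Y j h)))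
             (K.sym (K.*-distribˡ-sum (embed (c j)) λ h → G i h K.* embed (Y j h)))) ⟩
      ∑[ j < l ] (embed (c j) K.* act (Y j) i) ∎
      where
      open import Relation.Binary.Reasoning.Setoid K.setoid
      rearrange : ∀ a b c → a K.* (b K.* c) ≈ b K.* (a K.* c)
      rearrange a b c = K.trans (K.sym (K.*-assoc a b c))
        (K.trans (K.*-congʳ (K.*-comm a b)) (K.*-assoc b a c))

    productSpace : F.Matrix l n → K.Subspace k
    productSpace Y = K.columnSpace (G K.⊗ transpose (embedMatrix Y))

    act-∈ : (Y : F.Matrix l n) (v : F.Vec n) → v ∈ ⟦ F.span Y ⟧ → act v ∈ K.⟦ productSpace Y ⟧
    act-∈ Y v (c , e) = embed ∘ c , K.≋-trans (K.≋-sym (act-lincomb c Y)) (act-cong e)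

    productSpace-least : (Y : F.Matrix l n) (S : K.Subspace k) →
                         (∀ i → act (Y i) ∈ K.⟦ S ⟧) → productSpace Y K.≤ₛ S
    productSpace-least Y S = K.span-least S (act ∘ Y)

    productSpace-mono : ∀ {l l′} (Y : F.Matrix l n) (Z : F.Matrix l′ n) →
                        F.rowSpace Y ≤ₛ F.rowSpace Z → productSpace Y K.≤ₛ productSpace Z
    productSpace-mono Y Z Y≤Z = productSpace-least Y (productSpace Z)
      λ i → act-∈ Z (Y i) (Y≤Z (Y i) (F.∈-span Y i))

    ρᴳ : F.Subspace n → ℕ
    ρᴳ V = K.rank (G K.⊗ transpose (embedMatrix (F.basisMatrix V)))

    -- ρᴳ could have been defined using any matrix with row space V.
    ρᴳ-unique : (V : F.Subspace n) (Y : F.Matrix l n) → F.rowSpace Y ≐ₛ V →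
                ρᴳ V ≡ K.rank (G K.⊗ transpose (embedMatrix Y))
    ρᴳ-unique V Y (Y≤V , V≤Y) = K.dim-cong (productSpace B) (productSpace Y)
      ( productSpace-mono B Y (λ x x∈B → V≤Y x (proj₁ spanning x x∈B))
      , productSpace-mono Y B (λ x x∈Y → proj₂ spanning x (Y≤V x x∈Y)))
      where
      B = F.basisMatrix V
      open F.Basis (F.basis V) using (spanning)

    private
      S : F.Subspace n → K.Subspace k
      S V = productSpace (F.basisMatrix V)

      act∈S : ∀ V v → v ∈ ⟦ V ⟧ → act v ∈ K.⟦ S V ⟧
      act∈S V v v∈V = act-∈ (F.basisMatrix V) v (proj₂ (F.Basis.spanning (F.basis V)) v v∈V)

      S-least : ∀ V T → (∀ v → v ∈ ⟦ V ⟧ → act v ∈ K.⟦ T ⟧) → S V K.≤ₛ T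
      S-least V T V→T = productSpace-least (F.basisMatrix V) T λ i → V→T _ (F.basis∈ V i)

    ρᴳ-monotone : ∀ V W → V ≤ₛ W → ρᴳ V ℕ.≤ ρᴳ W
    ρᴳ-monotone V W V≤W = K.dim-mono (S V) (S W)
      (S-least V (S W) λ v v∈V → act∈S W v (V≤W v v∈V))

    ρᴳ-submodular : ∀ V W → ρᴳ (V +ₛ W) ℕ.+ ρᴳ (V ∩ₛ W) ℕ.≤ ρᴳ V ℕ.+ ρᴳ W
    ρᴳ-submodular V W = ℕ.≤-trans
      (ℕ.+-mono-≤
        (K.dim-mono (S (V +ₛ W)) (S V K.+ₛ S W) (S-least (V +ₛ W) (S V K.+ₛ S W)
          λ x (v , v∈V , w , w∈W , e) → act v , act∈S V v v∈V , act w , act∈S W w w∈W ,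
            K.≋-trans (K.≋-sym (act-+ v w)) (act-cong e)))
        (K.dim-mono (S (V ∩ₛ W)) (S V K.∩ₛ S W) (S-least (V ∩ₛ W) (S V K.∩ₛ S W)
          λ x (x∈V , x∈W) → act∈S V x x∈V , act∈S W x x∈W)))
      (ℕ.≤-reflexive (K.dim-modular (S V) (S W)))

    representedBy : QMatroid n
    representedBy = record
      { ρ          = ρᴳ
      ; ρ≤dim      = λ V → K.dim-span (act ∘ F.basisMatrix V)
      ; monotone   = ρᴳ-monotone
      ; submodular = ρᴳ-submodular
      }

{-# OPTIONS --safe #-}
-- Write φ(X) = ρ₁(π₁X) + ρ₂(π₂X). The rank of V in N is at most φ(V), with equality if V = π₁V ⊕ π₂V, since
-- the products G x lie in the sum of the spaces spanned by the G₁ x₁ and the G₂ x₂. This settles flats,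
-- circuits and independent spaces. If Z is cyclic in M₁ ⊕ M₂, the minimum defining its rank is attained
-- at Z itself, for otherwise a hyperplane of Z above a minimiser would have smaller rank; hence
-- π₁Z ⊕ π₂Z has the same rank as Z, and if Z is also a flat, then Z = π₁Z ⊕ π₂Z. For a hyperplane W of Z
-- missing a vector of π₁Z or π₂Z, cyclicity of Z in M₁ ⊕ M₂ shows that this summand has the same rank as
-- its intersection with W, so by submodularity W has the rank of Z in N as well.

module Submission where

open import Defs
open import Data.Empty using (⊥-elim)
open import Data.Fin.Base using (Fin; zero; suc; _↑ˡ_; _↑ʳ_)
open import Data.List.Base as List using (List; []; _∷_)
import Data.List.Relation.Unary.All as All
import Data.List.Relation.Unary.All.Properties as AllP
open import Data.Nat.Base as ℕ using (ℕ; zero; suc; _+_; _^_)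
import Data.Nat.Properties as ℕ
open import Data.Product.Base using (∃; ∃₂; _×_; _,_; proj₁; proj₂)
open import Data.Sum.Base using (_⊎_; inj₁; inj₂)
import Data.Vec.Functional as Vector
import Data.Vec.Functional.Properties as Vector
open import Function.Base using (_∘_)
open import Relation.Binary.PropositionalEquality as ≡ using (_≡_)
open import Relation.Nullary using (¬_; Dec; yes; no)
open import Relation.Nullary.Decidable using (decidable-stable; _×-dec_; ¬?)
open import Relation.Unary using (_∈_; _∉_)

private
  variable
    k m n : ℕ

-- Lattice and dimension of subspaces over a finite field.

module SubspaceProperties {q : ℕ} (𝔽 : FiniteField q) where
  open LinearAlgebra 𝔽 hiding (_+_)
  private module F = LinearAlgebra 𝔽

  ≤ₛ-trans : (U V W : Subspace n) → U ≤ₛ V → V ≤ₛ W → U ≤ₛ W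
  ≤ₛ-trans U V W U≤V V≤W x x∈U = V≤W x (U≤V x x∈U)

  ≤-+ₛˡ : (V W : Subspace n) → V ≤ₛ V +ₛ W
  ≤-+ₛˡ V W x x∈V = x , x∈V , 0ᵛ , 0∈ W , λ i → +-identityʳ (x i)

  ≤-+ₛʳ : (V W : Subspace n) → W ≤ₛ V +ₛ W
  ≤-+ₛʳ V W x x∈W = 0ᵛ , 0∈ V , x , x∈W , λ i → +-identityˡ (x i)

  +ₛ-least : (V W U : Subspace n) → V ≤ₛ U → W ≤ₛ U → V +ₛ W ≤ₛ U
  +ₛ-least V W U V≤U W≤U x (v , v∈V , w , w∈W , e) =
    resp U e (+∈ U (V≤U v v∈V) (W≤U w w∈W))

  +ₛ-monoʳ : (U V V′ : Subspace n) → V ≤ₛ V′ → U +ₛ V ≤ₛ U +ₛ V′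
  +ₛ-monoʳ U V V′ V≤V′ x (u , u∈U , v , v∈V , e) = u , u∈U , v , V≤V′ v v∈V , e

  x∈⟨x⟩ : (x : Vec n) → x ∈ ⟦ ⟨ x ⟩ ⟧
  x∈⟨x⟩ x = ∈-span (x Vector.∷ Vector.[]) zero

  ⟨⟩-least : (V : Subspace n) {x : Vec n} → x ∈ ⟦ V ⟧ → ⟨ x ⟩ ≤ₛ V
  ⟨⟩-least V {x} x∈V = span-least V (x Vector.∷ Vector.[]) λ { zero → x∈V }

  ∈⟨⟩⇒multiple : {x v : Vec n} → v ∈ ⟦ ⟨ x ⟩ ⟧ → ∃ λ c → c · x ≋ v
  ∈⟨⟩⇒multiple (c , e) = c zero , λ i → trans (sym (+-identityʳ _)) (e i)

  ∈-unscale : (V : Subspace n) {c : Carrier} {x : Vec n} →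
              ¬ c ≈ 0# → c · x ∈ ⟦ V ⟧ → x ∈ ⟦ V ⟧
  ∈-unscale V {c} {x} c≉0 cx∈V = let c⁻¹ , cc⁻¹≈1 = inverse c c≉0 in
    resp V (λ i → trans (sym (*-assoc c⁻¹ c (x i)))
      (trans (*-congʳ (trans (*-comm c⁻¹ c) cc⁻¹≈1)) (*-identityˡ (x i))))
      (·∈ V c⁻¹ cx∈V)

  -- A missing vector can be searched for exhaustively because the field is finite, so the
  -- alternative holds constructively.
  ≤ₛ-or-witness : (V W : Subspace n) → V ≤ₛ W ⊎ ∃ λ x → x ∈ ⟦ V ⟧ × x ∉ ⟦ W ⟧
  ≤ₛ-or-witness V W with search
      (λ x≋y (x∈V , x∉W) → resp V x≋y x∈V , λ y∈W → x∉W (resp W (≋-sym x≋y) y∈W))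
      (λ x → member? V x ×-dec ¬? (member? W x))
  ... | yes p = inj₂ p
  ... | no ¬p = inj₁ λ x x∈V → decidable-stable (member? W x) λ x∉W → ¬p (x , x∈V , x∉W)

  -- Steinitz exchange: write y = w + c x; then c is nonzero because y is outside `W`, and c can be
  -- inverted.
  exchange-⟨⟩ : (W : Subspace n) (x y : Vec n) →
                y ∈ ⟦ W +ₛ ⟨ x ⟩ ⟧ → y ∉ ⟦ W ⟧ → x ∈ ⟦ W +ₛ ⟨ y ⟩ ⟧
  exchange-⟨⟩ W x y (w , w∈W , v , v∈⟨x⟩ , e) y∉W with ∈⟨⟩⇒multiple v∈⟨x⟩
  ... | c , cx≋v = ∈-unscale (W +ₛ ⟨ y ⟩) c≉0
    (resp (W +ₛ ⟨ y ⟩) y-w≋cx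
      (-∈ (W +ₛ ⟨ y ⟩) (≤-+ₛʳ W ⟨ y ⟩ y (x∈⟨x⟩ y)) (≤-+ₛˡ W ⟨ y ⟩ w w∈W)))
    where
    y-w≋cx : y -ᵛ w ≋ c · x
    y-w≋cx i = trans (+-congʳ (sym (e i))) (trans (x+y-x (w i) (v i)) (sym (cx≋v i)))
    c≉0 : ¬ c ≈ 0#
    c≉0 c≈0 = y∉W (resp W (λ i → trans (sym (+-identityʳ (w i)))
      (trans (+-congˡ (trans (sym (trans (*-congʳ c≈0) (zeroˡ (x i)))) (cx≋v i))) (e i))) w∈W)

  -- If x = w + b with x in `A` and b in `B ≤ₛ A`, then w = x - b also lies in `A`.
  modular-law : (A B W : Subspace n) → B ≤ₛ A → A ∩ₛ (W +ₛ B) ≤ₛ (A ∩ₛ W) +ₛ B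
  modular-law A B W B≤A x (x∈A , w , w∈W , b , b∈B , e) =
    w , (resp A (λ i → trans (+-congʳ (trans (sym (e i)) (+-comm (w i) (b i)))) (x+y-x (b i) (w i)))
          (-∈ A x∈A (B≤A b b∈B)) , w∈W) , b , b∈B , e

  -- A basis of `V` stays independent when `x` is adjoined: a relation with nonzero coefficient at
  -- `x` would put `x` into `V`.
  dim-strict : (V W : Subspace n) (x : Vec n) → V ≤ₛ W → x ∈ ⟦ W ⟧ → x ∉ ⟦ V ⟧ →
               dim V ℕ.< dim W
  dim-strict V W x V≤W x∈W x∉V = independent⇒≤dim W (x Vector.∷ B)
    (λ { zero → x∈W ; (suc i) → V≤W (B i) (basis∈ V i) }) independent
    where
    B = basisMatrix V
    independent : LinearlyIndependent (x Vector.∷ B)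
    independent c e = λ { zero → c₀≈0 ; (suc i) → Basis.independent (basis V) (c ∘ suc)
        (λ j → trans (sym (+-identityˡ _)) (trans (+-congʳ
          (sym (trans (*-congʳ c₀≈0) (zeroˡ (x j))))) (e j))) i }
      where
      v = lincomb (c ∘ suc) B
      c₀≈0 : c zero ≈ 0#
      c₀≈0 = decidable-stable (c zero ≟ 0#) λ c₀≉0 → x∉V (∈-unscale V c₀≉0
        (resp V (λ i → trans (+-congʳ (sym (e i)))
            (trans (+-congʳ (+-comm _ _)) (x+y-x (v i) (c zero * x i))))
          (-∈ V (0∈ V) (lincomb-∈ V (c ∘ suc) B (basis∈ V)))))

  dim≥⇒≥ : (V W : Subspace n) → V ≤ₛ W → dim W ℕ.≤ dim V → W ≤ₛ V
  dim≥⇒≥ V W V≤W dimW≤dimV x x∈W = decidable-stable (member? V x) λ x∉V →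
    ℕ.<⇒≱ (dim-strict V W x V≤W x∈W x∉V) dimW≤dimV

  -- Downward induction from `V`. The recursion counts the basis vectors of `V` still to be adjoined
  -- to `X`; the invariant `V ≤ₛ X +ₛ span Y` forces `X ≐ₛ V` once none are left.
  ascent : ∀ {ℓ} (V : Subspace n) (P : Subspace n → Set ℓ) →
           (∀ X → X ≐ₛ V → P X) →
           (∀ X y → X ≤ₛ V → y ∈ ⟦ V ⟧ → P (X +ₛ ⟨ y ⟩) → P X) →
           ∀ X → X ≤ₛ V → P X
  ascent {n} V P top step X X≤V = go _ (basisMatrix V) X X≤V (basis∈ V)
    (λ x x∈V → ≤-+ₛʳ X (span (basisMatrix V)) x (proj₂ (Basis.spanning (basis V)) x x∈V))
    where
    go : ∀ k (Y : Matrix k n) X → X ≤ₛ V → (∀ i → Y i ∈ ⟦ V ⟧) → V ≤ₛ X +ₛ span Y → P X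
    go zero    Y X X≤V Y∈V V≤ = top X (X≤V ,
      ≤ₛ-trans V (X +ₛ span Y) X V≤ (+ₛ-least X (span Y) X (λ _ p → p) (span-least X Y λ ())))
    go (suc k) Y X X≤V Y∈V V≤ = step X (Y zero) X≤V (Y∈V zero)
      (go k (Y ∘ suc) X′ (+ₛ-least X ⟨ Y zero ⟩ V X≤V (⟨⟩-least V (Y∈V zero))) (Y∈V ∘ suc)
        (≤ₛ-trans V (X +ₛ span Y) T V≤ (+ₛ-least X (span Y) T X≤T (span-least T Y Y∈T))))
      where
      X′ = X +ₛ ⟨ Y zero ⟩
      T = X′ +ₛ span (Y ∘ suc)
      X≤T : X ≤ₛ T
      X≤T x x∈X = ≤-+ₛˡ X′ (span (Y ∘ suc)) x (≤-+ₛˡ X ⟨ Y zero ⟩ x x∈X)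
      Y∈T : ∀ i → Y i ∈ ⟦ T ⟧
      Y∈T zero    = ≤-+ₛˡ X′ (span (Y ∘ suc)) (Y zero) (≤-+ₛʳ X ⟨ Y zero ⟩ (Y zero) (x∈⟨x⟩ (Y zero)))
      Y∈T (suc i) = ≤-+ₛʳ X′ (span (Y ∘ suc)) (Y (suc i)) (∈-span (Y ∘ suc) i)

  -- Adjoin vectors of `V` to `X` one at a time; the last space before `V` is reached is a
  -- hyperplane of `V`.
  coatom-above : (X V : Subspace n) → X ≤ₛ V → ¬ V ≤ₛ X →
                 ∃₂ λ W x → X ≤ₛ W × W ≤ₛ V × W +ₛ ⟨ x ⟩ ≐ₛ V × dim W ℕ.< dim V
  coatom-above {n} X V X≤V = ascent V Coatom (λ X (_ , V≤X) V≰X → ⊥-elim (V≰X V≤X)) step X X≤V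
    where
    Coatom : Subspace n → Set₁
    Coatom X = ¬ V ≤ₛ X → ∃₂ λ W x → X ≤ₛ W × W ≤ₛ V × W +ₛ ⟨ x ⟩ ≐ₛ V × dim W ℕ.< dim V
    step : ∀ X y → X ≤ₛ V → y ∈ ⟦ V ⟧ → Coatom (X +ₛ ⟨ y ⟩) → Coatom X
    step X y X≤V y∈V rec V≰X with V ≤ₛ? (X +ₛ ⟨ y ⟩)
    ... | yes V≤ = X , y , (λ _ p → p) , X≤V ,
                   (+ₛ-least X ⟨ y ⟩ V X≤V (⟨⟩-least V y∈V) , V≤) ,
                   ℕ.≰⇒> (λ dimV≤ → V≰X (dim≥⇒≥ X V X≤V dimV≤))
    ... | no V≰ with rec V≰
    ...   | W , x , ≤W , rest = W , x , ≤ₛ-trans X (X +ₛ ⟨ y ⟩) W (≤-+ₛˡ X ⟨ y ⟩) ≤W , rest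

  -- Splitting coordinates: direct sums of subspaces and their projections.

  ≋-++ : {x y : Vec (m + n)} → x ∘ (_↑ˡ n) ≋ y ∘ (_↑ˡ n) → x ∘ (m ↑ʳ_) ≋ y ∘ (m ↑ʳ_) → x ≋ y
  ≋-++ {zero}  eˡ eʳ i       = eʳ i
  ≋-++ {suc m} eˡ eʳ zero    = eˡ zero
  ≋-++ {suc m} {n} {x} {y} eˡ eʳ (suc i) = ≋-++ {m} {n} {x ∘ suc} {y ∘ suc} (eˡ ∘ suc) eʳ i

  take-++ : (x : Vec m) (y : Vec n) → (x Vector.++ y) ∘ (_↑ˡ n) ≋ x
  take-++ x y i = reflexive (Vector.lookup-++ˡ x y i)

  drop-++ : (x : Vec m) (y : Vec n) → (x Vector.++ y) ∘ (m ↑ʳ_) ≋ y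
  drop-++ x y i = reflexive (Vector.lookup-++ʳ x y i)

  sum-++ : ∀ m {n} (f : Vec (m + n)) →
           sum f ≈ sum (f ∘ (_↑ˡ n)) F.+ sum (f ∘ (m ↑ʳ_))
  sum-++ zero    f = sym (+-identityˡ _)
  sum-++ (suc m) f = trans (+-congˡ (sum-++ m (f ∘ suc))) (sym (+-assoc _ _ _))

  ++-∈ : (V : Subspace m) (W : Subspace n) {x : Vec m} {y : Vec n} →
         x ∈ ⟦ V ⟧ → y ∈ ⟦ W ⟧ → x Vector.++ y ∈ ⟦ V ⊕ₛ W ⟧
  ++-∈ V W {x} {y} x∈V y∈W =
    resp V (≋-sym (take-++ x y)) x∈V , resp W (≋-sym (drop-++ x y)) y∈W

  ⊕ₛ-mono : (V V′ : Subspace m) (W W′ : Subspace n) →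
            V ≤ₛ V′ → W ≤ₛ W′ → V ⊕ₛ W ≤ₛ V′ ⊕ₛ W′
  ⊕ₛ-mono V V′ W W′ V≤ W≤ x (p , r) = V≤ _ p , W≤ _ r

  π₁-⊕ₛ : (V : Subspace m) (W : Subspace n) → π₁ m (V ⊕ₛ W) ≐ₛ V
  π₁-⊕ₛ V W = (λ y (x , (x₁∈V , _) , e) → resp V e x₁∈V)
            , (λ y y∈V → y Vector.++ 0ᵛ , ++-∈ V W y∈V (0∈ W) , take-++ y 0ᵛ)

  π₂-⊕ₛ : (V : Subspace m) (W : Subspace n) → π₂ m (V ⊕ₛ W) ≐ₛ W
  π₂-⊕ₛ {m} V W = (λ y (x , (_ , x₂∈W) , e) → resp W e x₂∈W)
            , (λ y y∈W → 0ᵛ {m} Vector.++ y , ++-∈ V W (0∈ V) y∈W , drop-++ (0ᵛ {m}) y)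

  fibre-⊕ₛ : (V : Subspace m) (W : Subspace n) → fibre m (V ⊕ₛ W) ≐ₛ W
  fibre-⊕ₛ {m} V W =
      (λ y (x , ((_ , x₂∈W) , _) , e) → resp W e x₂∈W)
    , (λ y y∈W → 0ᵛ {m} Vector.++ y ,
        (++-∈ V W (0∈ V) y∈W , take-++ (0ᵛ {m}) y , _) , drop-++ (0ᵛ {m}) y)

  dim-⊕ₛ : (V : Subspace m) (W : Subspace n) → dim (V ⊕ₛ W) ≡ dim V + dim W
  dim-⊕ₛ {m} V W = ≡.trans (dim-π₁+fibre m (V ⊕ₛ W))
    (≡.cong₂ _+_ (dim-cong _ V (π₁-⊕ₛ V W)) (dim-cong _ W (fibre-⊕ₛ V W)))

  dim-𝟎 : ∀ n → dim (𝟎 {n}) ≡ 0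
  dim-𝟎 n = dim-≤𝟎 (𝟎 {n}) λ _ p → p

  ≤-π⊕π : ∀ m {n} (U : Subspace (m + n)) → U ≤ₛ π₁ m U ⊕ₛ π₂ m U
  ≤-π⊕π m U x x∈U = (x , x∈U , ≋-refl) , (x , x∈U , ≋-refl)

  𝟎-least : (V : Subspace n) → 𝟎 ≤ₛ V
  𝟎-least V x x≋0 = resp V (≋-sym x≋0) (0∈ V)

  -- Vectors of `U` vanish in the second block, so `x` agrees there with `u` as well and hence
  -- equals `u`.
  ≤⊕𝟎⇒split : (V : Subspace m) (U : Subspace (m + n)) → U ≤ₛ V ⊕ₛ 𝟎 → π₁ m U ⊕ₛ π₂ m U ≤ₛ U
  ≤⊕𝟎⇒split {m} {n} V U U≤ x ((u , u∈U , e) , (w , w∈U , e′)) = resp U (≋-++ {m} {n} e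
    (≋-trans (proj₂ (U≤ u u∈U)) (≋-trans (≋-sym (proj₂ (U≤ w w∈U))) e′))) u∈U

  ≤𝟎⊕⇒split : (V : Subspace n) (U : Subspace (m + n)) → U ≤ₛ 𝟎 ⊕ₛ V → π₁ m U ⊕ₛ π₂ m U ≤ₛ U
  ≤𝟎⊕⇒split {n} {m} V U U≤ x ((u , u∈U , e) , (w , w∈U , e′)) = resp U (≋-++ {m} {n}
    (≋-trans (proj₁ (U≤ w w∈U)) (≋-trans (≋-sym (proj₁ (U≤ u u∈U))) e)) e′) w∈U

  ⊕ₛ-+ₛ : (V V′ : Subspace m) (W W′ : Subspace n) →
          (V +ₛ V′) ⊕ₛ (W +ₛ W′) ≐ₛ (V ⊕ₛ W) +ₛ (V′ ⊕ₛ W′)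
  ⊕ₛ-+ₛ {m} {n} V V′ W W′ =
      (λ x ((v , v∈ , v′ , v′∈ , e) , (w , w∈ , w′ , w′∈ , e′)) →
        v Vector.++ w , ++-∈ V W v∈ w∈ , v′ Vector.++ w′ , ++-∈ V′ W′ v′∈ w′∈ ,
        ≋-++ {m} {n}
          (λ i → trans (+-cong (take-++ v w i) (take-++ v′ w′ i)) (e i))
          (λ i → trans (+-cong (drop-++ v w i) (drop-++ v′ w′ i)) (e′ i)))
    , (λ x (y , (y₁∈ , y₂∈) , z , (z₁∈ , z₂∈) , e) →
        (y ∘ (_↑ˡ n) , y₁∈ , z ∘ (_↑ˡ n) , z₁∈ , e ∘ (_↑ˡ n)) ,
        (y ∘ (m ↑ʳ_) , y₂∈ , z ∘ (m ↑ʳ_) , z₂∈ , e ∘ (m ↑ʳ_)))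

  -- Summands are peeled off one at a time by `⊕ₛ-+ₛ`, padding the other block with `𝟎`. Applied to
  -- lists of circuits, this decomposes the direct sum of two open spaces.
  ∑ₛ-⊕ₛ : (Vs : List (Subspace m)) (Ws : List (Subspace n)) →
          ∑ₛ Vs ⊕ₛ ∑ₛ Ws ≐ₛ ∑ₛ (List.map (_⊕ₛ 𝟎) Vs List.++ List.map (𝟎 ⊕ₛ_) Ws)
  ∑ₛ-⊕ₛ {m} {n} [] [] = (λ x (p , r) → ≋-++ {m} {n} p r)
                      , (λ x x≋0 → x≋0 ∘ (_↑ˡ n) , x≋0 ∘ (m ↑ʳ_))
  ∑ₛ-⊕ₛ {m} {n} [] (W ∷ Ws) =
      (λ x (p , r) → +ₛ-monoʳ (𝟎 ⊕ₛ W) (𝟎 ⊕ₛ ∑ₛ Ws) T (proj₁ IH) x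
        (proj₁ (⊕ₛ-+ₛ 𝟎 𝟎 W (∑ₛ Ws)) x (≤-+ₛˡ 𝟎 𝟎 _ p , r)))
    , (λ x x∈ → let p , r = proj₂ (⊕ₛ-+ₛ 𝟎 𝟎 W (∑ₛ Ws)) x
                              (+ₛ-monoʳ (𝟎 ⊕ₛ W) T (𝟎 ⊕ₛ ∑ₛ Ws) (proj₂ IH) x x∈)
                in +ₛ-least 𝟎 𝟎 𝟎 (λ _ p → p) (λ _ p → p) _ p , r)
    where
    T = ∑ₛ (List.map (𝟎 {m} ⊕ₛ_) Ws)
    IH = ∑ₛ-⊕ₛ {m} [] Ws
  ∑ₛ-⊕ₛ {m} {n} (V ∷ Vs) Ws =
      (λ x (p , r) → +ₛ-monoʳ (V ⊕ₛ 𝟎) (∑ₛ Vs ⊕ₛ ∑ₛ Ws) T (proj₁ IH) x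
        (proj₁ (⊕ₛ-+ₛ V (∑ₛ Vs) 𝟎 (∑ₛ Ws)) x (p , ≤-+ₛʳ 𝟎 (∑ₛ Ws) _ r)))
    , (λ x x∈ → let p , r = proj₂ (⊕ₛ-+ₛ V (∑ₛ Vs) 𝟎 (∑ₛ Ws)) x
                              (+ₛ-monoʳ (V ⊕ₛ 𝟎) T (∑ₛ Vs ⊕ₛ ∑ₛ Ws) (proj₂ IH) x x∈)
                in p , +ₛ-least 𝟎 (∑ₛ Ws) (∑ₛ Ws)
                         (𝟎-least (∑ₛ Ws)) (λ _ p → p) _ r)
    where
    T = ∑ₛ (List.map (_⊕ₛ 𝟎) Vs List.++ List.map (𝟎 ⊕ₛ_) Ws)
    IH = ∑ₛ-⊕ₛ Vs Ws

  image-+⟨⟩ : (f : Fin m → Fin n) (V : Subspace n) (x : Vec n) →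
              image f (V +ₛ ⟨ x ⟩) ≤ₛ image f V +ₛ ⟨ x ∘ f ⟩
  image-+⟨⟩ f V x y (z , (v , v∈V , w , (c , e) , e′) , e″) =
    v ∘ f , (v , v∈V , ≋-refl) , w ∘ f , (c , e ∘ f) , ≋-trans (e′ ∘ f) e″

-- General properties of q-matroids: closure, nullity and circuits.

module QMatroidProperties {q : ℕ} (𝔽 : FiniteField q) where
  open LinearAlgebra 𝔽 hiding (_+_)
  open QMatroids 𝔽
  open SubspaceProperties 𝔽

  module _ (M : QMatroid n) where
    open QMatroid M

    ρ-cong : (V W : Subspace n) → V ≐ₛ W → ρ V ≡ ρ W
    ρ-cong V W (V≤W , W≤V) = ℕ.≤-antisym (monotone V W V≤W) (monotone W V W≤V)

    ρ-+-≤ : (V W : Subspace n) → ρ (V +ₛ W) ℕ.≤ ρ V + ρ W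
    ρ-+-≤ V W = ℕ.≤-trans (ℕ.m≤m+n _ _) (submodular V W)

    ρ-𝟎 : ρ 𝟎 ≡ 0
    ρ-𝟎 = ℕ.n≤0⇒n≡0 (≡.subst (ρ 𝟎 ℕ.≤_) (dim-𝟎 n) (ρ≤dim 𝟎))

    -- `V` is kept apart from `F` because the projection of a direct sum equals its summand only up
    -- to `≐ₛ`.
    flat⇒closed : (F : Subspace n) → IsFlat M F → (V : Subspace n) → V ≐ₛ F →
                  ∀ x → ρ (V +ₛ ⟨ x ⟩) ℕ.≤ ρ V → x ∈ ⟦ F ⟧
    flat⇒closed F flat V (V≤F , F≤V) x ρ[V+x]≤ρV = decidable-stable (member? F x) λ x∉F →
      ℕ.<⇒≱ (flat x x∉F) (begin
        ρ (F +ₛ ⟨ x ⟩)  ≤⟨ monotone (F +ₛ ⟨ x ⟩) (V +ₛ ⟨ x ⟩) (+ₛ-least F ⟨ x ⟩ (V +ₛ ⟨ x ⟩)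
                             (≤ₛ-trans F V (V +ₛ ⟨ x ⟩) F≤V (≤-+ₛˡ V ⟨ x ⟩)) (≤-+ₛʳ V ⟨ x ⟩)) ⟩
        ρ (V +ₛ ⟨ x ⟩)  ≤⟨ ρ[V+x]≤ρV ⟩
        ρ V             ≤⟨ monotone V F V≤F ⟩
        ρ F             ∎)
      where open ℕ.≤-Reasoning

    -- Monotonicity of the nullity dim - ρ, written without subtraction. Adjoining a vector outside
    -- `X` raises the rank by at most 1 and the dimension by at least 1.
    ρ-slope : (X V : Subspace n) → X ≤ₛ V → ρ V + dim X ℕ.≤ ρ X + dim V
    ρ-slope X V = ascent V (λ X → ρ V + dim X ℕ.≤ ρ X + dim V)
      (λ X (X≤V , V≤X) → ℕ.+-mono-≤ (monotone V X V≤X) (dim-mono X V X≤V)) step X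
      where
      step : ∀ X y → X ≤ₛ V → y ∈ ⟦ V ⟧ →
             ρ V + dim (X +ₛ ⟨ y ⟩) ℕ.≤ ρ (X +ₛ ⟨ y ⟩) + dim V → ρ V + dim X ℕ.≤ ρ X + dim V
      step X y X≤V y∈V IH = go (member? X y)
        where
        open ℕ.≤-Reasoning
        go : Dec (y ∈ ⟦ X ⟧) → ρ V + dim X ℕ.≤ ρ X + dim V
        go (yes y∈X) = begin
          ρ V + dim X                 ≤⟨ ℕ.+-monoʳ-≤ (ρ V) (dim-mono X (X +ₛ ⟨ y ⟩) (≤-+ₛˡ X ⟨ y ⟩)) ⟩
          ρ V + dim (X +ₛ ⟨ y ⟩)      ≤⟨ IH ⟩
          ρ (X +ₛ ⟨ y ⟩) + dim V      ≤⟨ ℕ.+-monoˡ-≤ (dim V) (monotone (X +ₛ ⟨ y ⟩) X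
                                           (+ₛ-least X ⟨ y ⟩ X (λ _ p → p) (⟨⟩-least X y∈X))) ⟩
          ρ X + dim V                 ∎
        go (no y∉X) = ℕ.s≤s⁻¹ (begin
          suc (ρ V + dim X)           ≡⟨ ≡.sym (ℕ.+-suc (ρ V) (dim X)) ⟩
          ρ V + suc (dim X)           ≤⟨ ℕ.+-monoʳ-≤ (ρ V) (dim-strict X (X +ₛ ⟨ y ⟩) y
                                           (≤-+ₛˡ X ⟨ y ⟩) (≤-+ₛʳ X ⟨ y ⟩ y (x∈⟨x⟩ y)) y∉X) ⟩
          ρ V + dim (X +ₛ ⟨ y ⟩)      ≤⟨ IH ⟩
          ρ (X +ₛ ⟨ y ⟩) + dim V      ≤⟨ ℕ.+-monoˡ-≤ (dim V) (ρ-+-≤ X ⟨ y ⟩) ⟩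
          ρ X + ρ ⟨ y ⟩ + dim V       ≤⟨ ℕ.+-monoˡ-≤ (dim V) (ℕ.+-monoʳ-≤ (ρ X)
                                           (ℕ.≤-trans (ρ≤dim ⟨ y ⟩) (dim-span (y Vector.∷ Vector.[])))) ⟩
          ρ X + 1 + dim V             ≡⟨ ≡.cong (_+ dim V) (ℕ.+-comm (ρ X) 1) ⟩
          suc (ρ X + dim V)           ∎)

    -- The nullity of `V` is 0, so by `ρ-slope` that of `X` is too.
    independent-⊆ : (X V : Subspace n) → X ≤ₛ V → IsIndependent M V → IsIndependent M X
    independent-⊆ X V X≤V ρV≡dimV = ℕ.≤-antisym (ρ≤dim X) (ℕ.+-cancelˡ-≤ (dim V) _ _ (begin
      dim V + dim X ≡⟨ ≡.cong (_+ dim X) (≡.sym ρV≡dimV) ⟩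
      ρ V + dim X   ≤⟨ ρ-slope X V X≤V ⟩
      ρ X + dim V   ≡⟨ ℕ.+-comm (ρ X) (dim V) ⟩
      dim V + ρ X   ∎))
      where open ℕ.≤-Reasoning

  -- As `ι` preserves rank and dimension, dependence carries over; minimality does because every
  -- subspace of `ι V` comes from a subspace of `V`. Both coordinate embeddings are instances.
  circuit-embed : (M : QMatroid m) (N : QMatroid n)
                  (ι : Subspace m → Subspace n) (κ : Subspace n → Subspace m) →
                  (∀ U V → U ≤ₛ V → ι U ≤ₛ ι V) →
                  (∀ V → QMatroid.ρ N (ι V) ≡ QMatroid.ρ M V) →
                  (∀ V → dim (ι V) ≡ dim V) →
                  (∀ V D → D ≤ₛ ι V → κ D ≤ₛ V × D ≐ₛ ι (κ D)) →
                  ∀ {C} → IsCircuit M C → IsCircuit N (ι C)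
  circuit-embed M N ι κ ι-mono ρ-ι dim-ι sub {C} (dependent , minimal) =
      (λ ρ≡dim → dependent (≡.trans (≡.sym (ρ-ι C)) (≡.trans ρ≡dim (dim-ι C))))
    , λ D D≤ιC ιC≰D → let κD≤C , D≤ικD , ικD≤D = sub C D D≤ιC in begin
        N.ρ D         ≡⟨ ρ-cong N D (ι (κ D)) (D≤ικD , ικD≤D) ⟩
        N.ρ (ι (κ D)) ≡⟨ ρ-ι (κ D) ⟩
        M.ρ (κ D)     ≡⟨ minimal (κ D) κD≤C (λ C≤κD → ιC≰D
                           (≤ₛ-trans (ι C) (ι (κ D)) D (ι-mono C (κ D) C≤κD) ικD≤D)) ⟩
        dim (κ D)     ≡⟨ ≡.sym (dim-ι (κ D)) ⟩
        dim (ι (κ D)) ≡⟨ ≡.sym (dim-cong D (ι (κ D)) (D≤ικD , ικD≤D)) ⟩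
        dim D         ∎
    where
    open ≡.≡-Reasoning
    module M = QMatroid M
    module N = QMatroid N

  -- The rank function of the direct sum compared with φ.

  module DirectSumProperties (M₁ : QMatroid m) (M₂ : QMatroid n) where
    open DirectSum M₁ M₂
    private
      module M₁ = QMatroid M₁
      module M₂ = QMatroid M₂

    -- Take X = `V` in the minimum.
    ρ⊕≤φ : ∀ V → ρ⊕ V ℕ.≤ φ V
    ρ⊕≤φ V = ℕ.+-cancelʳ-≤ (dim V) _ _ (ℕ.≤-trans (ρ⊕-minimal V V (λ _ p → p))
      (ℕ.≤-reflexive (ℕ.+-comm (dim V) (φ V))))

    -- Two spellings of the same ρ⊕ V are too expensive to compare by unfolding. In the next two lemmas a
    -- and X are read off from one spelling, after which each remaining equation is a cheap refl.
    ρ⊕-unique : ∀ V {a X} → X ≡ minimiser V → a ≡ dim V + φ X → a ℕ.∸ dim X ≡ ρ⊕ V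
    ρ⊕-unique V ≡.refl ≡.refl = ≡.refl

    ρ⊕-relate : (R : ℕ → ℕ → Set) → ∀ V W {a b X Y} → R (a ℕ.∸ dim X) (b ℕ.∸ dim Y) →
                X ≡ minimiser V → a ≡ dim V + φ X → Y ≡ minimiser W → b ≡ dim W + φ Y →
                R (ρ⊕ V) (ρ⊕ W)
    ρ⊕-relate R V W r ≡.refl ≡.refl ≡.refl ≡.refl = r

    φ-⊕ₛ : ∀ V W → φ (V ⊕ₛ W) ≡ M₁.ρ V + M₂.ρ W
    φ-⊕ₛ V W = ≡.cong₂ _+_ (ρ-cong M₁ _ V (π₁-⊕ₛ V W)) (ρ-cong M₂ _ W (π₂-⊕ₛ V W))

    φ-+-≤ : ∀ V W → φ (V +ₛ W) ℕ.≤ φ V + φ W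
    φ-+-≤ V W = ℕ.≤-trans (ℕ.m≤m+n _ _) (φ-submodular V W)

    φ-+⟨⟩ : ∀ V x → φ (V +ₛ ⟨ x ⟩) ℕ.≤
            M₁.ρ (π₁ m V +ₛ ⟨ x ∘ (_↑ˡ n) ⟩) + M₂.ρ (π₂ m V +ₛ ⟨ x ∘ (m ↑ʳ_) ⟩)
    φ-+⟨⟩ V x = ℕ.+-mono-≤
      (M₁.monotone _ _ (image-+⟨⟩ (_↑ˡ n) V x)) (M₂.monotone _ _ (image-+⟨⟩ (m ↑ʳ_) V x))

    -- If X attains the minimum defining ρ⊕ V, a hyperplane of V above X has smaller rank than V.
    attained⇒φ≤ρ⊕ : ∀ V X → X ≤ₛ V → ρ⊕ V + dim X ≡ dim V + φ X →
                     IsCyclic (M₁ ⊕ M₂) V → φ V ℕ.≤ ρ⊕ V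
    attained⇒φ≤ρ⊕ V X X≤V attained (_ , V⊆cyc) = go (V ≤ₛ? X)
      where
      open ℕ.≤-Reasoning
      go : Dec (V ≤ₛ X) → φ V ℕ.≤ ρ⊕ V
      go (yes V≤X) = ℕ.+-cancelˡ-≤ (dim V) _ _ (begin
        dim V + φ V      ≤⟨ ℕ.+-monoʳ-≤ (dim V) (φ-mono V X V≤X) ⟩
        dim V + φ X      ≡⟨ ≡.sym attained ⟩
        ρ⊕ V + dim X     ≤⟨ ℕ.+-monoʳ-≤ (ρ⊕ V) (dim-mono X V X≤V) ⟩
        ρ⊕ V + dim V     ≡⟨ ℕ.+-comm (ρ⊕ V) (dim V) ⟩
        dim V + ρ⊕ V     ∎)
      go (no V≰X) = let W , x , X≤W , W≤V , W+x≐V , dimW<dimV = coatom-above X V X≤V V≰X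
                        x∈V = proj₁ W+x≐V x (≤-+ₛʳ W ⟨ x ⟩ x (x∈⟨x⟩ x))
        in ⊥-elim (ℕ.<-irrefl ≡.refl (begin-strict
          ρ⊕ V + dim X ≡⟨ ≡.cong (_+ dim X) (≡.sym (proj₂ (V⊆cyc x∈V) W W≤V W+x≐V)) ⟩
          ρ⊕ W + dim X ≤⟨ ρ⊕-minimal W X X≤W ⟩
          dim W + φ X  <⟨ ℕ.+-monoˡ-< (φ X) dimW<dimV ⟩
          dim V + φ X  ≡⟨ ≡.sym attained ⟩
          ρ⊕ V + dim X ∎))

    cyclic⇒φ≤ρ⊕ : ∀ V → IsCyclic (M₁ ⊕ M₂) V → φ V ℕ.≤ ρ⊕ V
    cyclic⇒φ≤ρ⊕ V = attained⇒φ≤ρ⊕ V (minimiser V) (minimiser-≤ V) (ρ⊕-attained V)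

    -- Passing from `V` to the sum of its projections does not change φ. Since φ and the rank agree
    -- on the cyclic space `V`, the rank does not grow either, and a flat admits no such
    -- enlargement.
    cyclicFlat⇒split : ∀ V → 𝒵 (M₁ ⊕ M₂) V → π₁ m V ⊕ₛ π₂ m V ≤ₛ V
    cyclicFlat⇒split V (flat , cyclic) x x∈V′ = decidable-stable (member? V x) λ x∉V →
      ℕ.<⇒≱ (flat x x∉V) (begin
        ρ⊕ (V +ₛ ⟨ x ⟩)             ≤⟨ ρ⊕-monotone (V +ₛ ⟨ x ⟩) V′
                                         (+ₛ-least V ⟨ x ⟩ V′ (≤-π⊕π m V) (⟨⟩-least V′ x∈V′)) ⟩
        ρ⊕ V′                       ≤⟨ ρ⊕≤φ V′ ⟩
        φ V′                        ≡⟨ φ-⊕ₛ (π₁ m V) (π₂ m V) ⟩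
        φ V                         ≤⟨ cyclic⇒φ≤ρ⊕ V cyclic ⟩
        ρ⊕ V                        ∎)
      where
      open ℕ.≤-Reasoning
      V′ = π₁ m V ⊕ₛ π₂ m V

  -- The four assertions for an abstract block sum.

  -- All that the theorem uses of the q-matroid N represented by a block diagonal matrix: its rank is at
  -- most φ, with equality on the sums V = π₁ V ⊕ₛ π₂ V, and if x lies in the closure of V, then the
  -- projections of x lie in the closures of those of V.
  module BlockSum (M₁ : QMatroid m) (M₂ : QMatroid n) (N : QMatroid (m + n))
    (ρ≤φ : ∀ V → QMatroid.ρ N V ℕ.≤ DirectSum.φ M₁ M₂ V)
    (φ≤ρ : ∀ V → π₁ m V ⊕ₛ π₂ m V ≤ₛ V → DirectSum.φ M₁ M₂ V ℕ.≤ QMatroid.ρ N V)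
    (closure-π : ∀ V x → QMatroid.ρ N (V +ₛ ⟨ x ⟩) ℕ.≤ QMatroid.ρ N V →
                 QMatroid.ρ M₁ (π₁ m V +ₛ ⟨ x ∘ (_↑ˡ n) ⟩) ℕ.≤ QMatroid.ρ M₁ (π₁ m V) ×
                 QMatroid.ρ M₂ (π₂ m V +ₛ ⟨ x ∘ (m ↑ʳ_) ⟩) ℕ.≤ QMatroid.ρ M₂ (π₂ m V))
    where
    open DirectSum M₁ M₂
    private
      module M₁ = QMatroid M₁
      module M₂ = QMatroid M₂
      module N = QMatroid N
    open DirectSumProperties M₁ M₂

    ρ-⊕ₛ : ∀ V W → N.ρ (V ⊕ₛ W) ≡ M₁.ρ V + M₂.ρ W
    ρ-⊕ₛ V W = ≡.trans (ℕ.≤-antisym (ρ≤φ (V ⊕ₛ W)) (φ≤ρ (V ⊕ₛ W)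
        (⊕ₛ-mono (π₁ m (V ⊕ₛ W)) V (π₂ m (V ⊕ₛ W)) W (proj₁ (π₁-⊕ₛ V W)) (proj₁ (π₂-⊕ₛ V W)))))
      (φ-⊕ₛ V W)

    -- A vector that leaves the rank of `F` unchanged projects into the closures of `F₁` and `F₂`,
    -- which are `F₁` and `F₂`.
    ⊕ₛ-flat : ∀ F₁ F₂ → IsFlat M₁ F₁ → IsFlat M₂ F₂ → IsFlat N (F₁ ⊕ₛ F₂)
    ⊕ₛ-flat F₁ F₂ flat₁ flat₂ x x∉F = ℕ.≰⇒> λ ρ[F+x]≤ρF → let p , r = closure-π F x ρ[F+x]≤ρF in
      x∉F ( flat⇒closed M₁ F₁ flat₁ (π₁ m F) (π₁-⊕ₛ F₁ F₂) (x ∘ (_↑ˡ n)) p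
          , flat⇒closed M₂ F₂ flat₂ (π₂ m F) (π₂-⊕ₛ F₁ F₂) (x ∘ (m ↑ʳ_)) r )
      where F = F₁ ⊕ₛ F₂

    -- The minimiser X inherits independence in `N`, so dim X = `N.ρ X` ≤ φ X, and the minimum
    -- cannot drop below dim `V`.
    independent⇒independent⊕ : ∀ V → IsIndependent N V → IsIndependent (M₁ ⊕ M₂) V
    independent⇒independent⊕ V indep = ℕ.≤-antisym (ρ⊕≤dim V)
      (ℕ.+-cancelʳ-≤ (dim X) _ _ (begin
        dim V + dim X  ≡⟨ ≡.cong (dim V +_) (≡.sym (independent-⊆ N X V (minimiser-≤ V) indep)) ⟩
        dim V + N.ρ X  ≤⟨ ℕ.+-monoʳ-≤ (dim V) (ρ≤φ X) ⟩
        dim V + φ X    ≡⟨ ≡.sym (ρ⊕-attained V) ⟩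
        ρ⊕ V + dim X   ∎))
      where
      open ℕ.≤-Reasoning
      X = minimiser V

    ρ-⊕𝟎 : ∀ V → N.ρ (V ⊕ₛ 𝟎) ≡ M₁.ρ V
    ρ-⊕𝟎 V = ≡.trans (ρ-⊕ₛ V 𝟎) (≡.trans (≡.cong (M₁.ρ V +_) (ρ-𝟎 M₂)) (ℕ.+-identityʳ _))

    ρ-𝟎⊕ : ∀ V → N.ρ (𝟎 ⊕ₛ V) ≡ M₂.ρ V
    ρ-𝟎⊕ V = ≡.trans (ρ-⊕ₛ 𝟎 V) (≡.cong (_+ M₂.ρ V) (ρ-𝟎 M₁))

    ⊕𝟎-circuit : ∀ {C} → IsCircuit M₁ C → IsCircuit N (C ⊕ₛ 𝟎)
    ⊕𝟎-circuit = circuit-embed M₁ N (_⊕ₛ 𝟎) (π₁ m)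
      (λ U V U≤V → ⊕ₛ-mono U V 𝟎 𝟎 U≤V (λ _ p → p))
      ρ-⊕𝟎
      (λ V → ≡.trans (dim-⊕ₛ V 𝟎)
        (≡.trans (≡.cong (dim V +_) (dim-𝟎 n)) (ℕ.+-identityʳ _)))
      -- A subspace of `V ⊕ₛ 𝟎` is recovered from its first projection.
      (λ V D D≤ → (λ y (x , x∈D , e) → resp V e (proj₁ (D≤ x x∈D)))
                , (λ x x∈D → (x , x∈D , ≋-refl) , proj₂ (D≤ x x∈D))
                , ≤ₛ-trans (π₁ m D ⊕ₛ 𝟎) (π₁ m D ⊕ₛ π₂ m D) D
                    (⊕ₛ-mono (π₁ m D) (π₁ m D) 𝟎 (π₂ m D) (λ _ p → p) (𝟎-least (π₂ m D)))
                    (≤⊕𝟎⇒split V D D≤))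

    𝟎⊕-circuit : ∀ {C} → IsCircuit M₂ C → IsCircuit N (𝟎 ⊕ₛ C)
    𝟎⊕-circuit = circuit-embed M₂ N (𝟎 ⊕ₛ_) (π₂ m)
      (λ U V U≤V → ⊕ₛ-mono 𝟎 𝟎 U V (λ _ p → p) U≤V)
      ρ-𝟎⊕
      (λ V → ≡.trans (dim-⊕ₛ (𝟎 {m}) V) (≡.cong (_+ dim V) (dim-𝟎 m)))
      (λ V D D≤ → (λ y (x , x∈D , e) → resp V e (proj₂ (D≤ x x∈D)))
                , (λ x x∈D → proj₁ (D≤ x x∈D) , (x , x∈D , ≋-refl))
                , ≤ₛ-trans (𝟎 ⊕ₛ π₂ m D) (π₁ m D ⊕ₛ π₂ m D) D
                    (⊕ₛ-mono 𝟎 (π₁ m D) (π₂ m D) (π₂ m D) (𝟎-least (π₁ m D)) (λ _ p → p))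
                    (≤𝟎⊕⇒split V D D≤))

    ⊕ₛ-open : ∀ O₁ O₂ → IsOpen M₁ O₁ → IsOpen M₂ O₂ → IsOpen N (O₁ ⊕ₛ O₂)
    ⊕ₛ-open O₁ O₂ (Cs , Cs-circuits , O₁≤ , ≤O₁) (Ds , Ds-circuits , O₂≤ , ≤O₂) =
        Es
      , AllP.++⁺ (AllP.map⁺ (All.map ⊕𝟎-circuit Cs-circuits))
                (AllP.map⁺ (All.map 𝟎⊕-circuit Ds-circuits))
      , ≤ₛ-trans (O₁ ⊕ₛ O₂) ΣCs⊕ΣDs (∑ₛ Es)
          (⊕ₛ-mono O₁ (∑ₛ Cs) O₂ (∑ₛ Ds) O₁≤ O₂≤) (proj₁ (∑ₛ-⊕ₛ Cs Ds))
      , ≤ₛ-trans (∑ₛ Es) ΣCs⊕ΣDs (O₁ ⊕ₛ O₂)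
          (proj₂ (∑ₛ-⊕ₛ Cs Ds)) (⊕ₛ-mono (∑ₛ Cs) O₁ (∑ₛ Ds) O₂ ≤O₁ ≤O₂)
      where
      Es = List.map (_⊕ₛ 𝟎) Cs List.++ List.map (𝟎 ⊕ₛ_) Ds
      ΣCs⊕ΣDs = ∑ₛ Cs ⊕ₛ ∑ₛ Ds

    -- If `x` is in the closure of `Z` in `N`, adjoining it does not raise φ. Cyclicity gives φ `Z`
    -- ≤ `ρ⊕ Z`, so the rank in the direct sum would not rise either.
    cyclicFlat⇒flat : ∀ Z → 𝒵 (M₁ ⊕ M₂) Z → IsFlat N Z
    cyclicFlat⇒flat Z (flat , cyclic) x x∉Z = ℕ.≰⇒> λ ρ[Z+x]≤ρZ →
      let p , r = closure-π Z x ρ[Z+x]≤ρZ in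
      ℕ.<⇒≱ (flat x x∉Z) (begin
        ρ⊕ (Z +ₛ ⟨ x ⟩)   ≤⟨ ρ⊕≤φ (Z +ₛ ⟨ x ⟩) ⟩
        φ (Z +ₛ ⟨ x ⟩)    ≤⟨ φ-+⟨⟩ Z x ⟩
        M₁.ρ (π₁ m Z +ₛ ⟨ x ∘ (_↑ˡ n) ⟩) + M₂.ρ (π₂ m Z +ₛ ⟨ x ∘ (m ↑ʳ_) ⟩)
                          ≤⟨ ℕ.+-mono-≤ p r ⟩
        φ Z               ≤⟨ cyclic⇒φ≤ρ⊕ Z cyclic ⟩
        ρ⊕ Z              ∎)
      where open ℕ.≤-Reasoning

    -- As ((A ∩ W) + B) + ⟨z⟩ = Z, the space (A ∩ W) + B has full rank in M₁ ⊕ M₂.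
    summand-≰⇒ρ≤ : ∀ Z W x A B → IsCyclic (M₁ ⊕ M₂) Z → W +ₛ ⟨ x ⟩ ≐ₛ Z →
                   A +ₛ B ≐ₛ Z → φ A + φ B ≡ φ Z → (∀ U → U ≤ₛ A → φ U ℕ.≤ N.ρ U) →
                   ∀ z → z ∈ ⟦ A ⟧ → z ∉ ⟦ W ⟧ → N.ρ Z ℕ.≤ N.ρ W
    summand-≰⇒ρ≤ Z W x A B cyclic@(_ , Z⊆cyc) (_ , Z≤W+x) (A+B≤Z , Z≤A+B) φA+φB φ≤ρ-below z z∈A z∉W =
      ℕ.+-cancelʳ-≤ (N.ρ U) _ _ (begin
        -- Submodularity for `W` and `A` reduces the claim to `N.ρ A` ≤ `N.ρ U`.
        N.ρ Z + N.ρ U                    ≤⟨ ℕ.+-mono-≤ (N.monotone Z (W +ₛ A) Z≤W+A)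
                                              (N.monotone U (W ∩ₛ A) λ _ (p , r) → r , p) ⟩
        N.ρ (W +ₛ A) + N.ρ (W ∩ₛ A)      ≤⟨ N.submodular W A ⟩
        N.ρ W + N.ρ A                    ≤⟨ ℕ.+-monoʳ-≤ (N.ρ W) (ℕ.+-cancelʳ-≤ (φ B) _ _ ρA+φB≤ρU+φB) ⟩
        N.ρ W + N.ρ U                    ∎)
      where
      open ℕ.≤-Reasoning
      U = A ∩ₛ W
      A≤Z : A ≤ₛ Z
      A≤Z = ≤ₛ-trans A (A +ₛ B) Z (≤-+ₛˡ A B) A+B≤Z
      B≤Z : B ≤ₛ Z
      B≤Z = ≤ₛ-trans B (A +ₛ B) Z (≤-+ₛʳ A B) A+B≤Z
      z∈Z : z ∈ ⟦ Z ⟧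
      z∈Z = A≤Z z z∈A
      U+B≤Z : U +ₛ B ≤ₛ Z
      U+B≤Z = +ₛ-least U B Z (λ y (y∈A , _) → A≤Z y y∈A) B≤Z
      Z≤W+z : Z ≤ₛ W +ₛ ⟨ z ⟩
      Z≤W+z = ≤ₛ-trans Z (W +ₛ ⟨ x ⟩) (W +ₛ ⟨ z ⟩) Z≤W+x
        (+ₛ-least W ⟨ x ⟩ (W +ₛ ⟨ z ⟩) (≤-+ₛˡ W ⟨ z ⟩)
          (⟨⟩-least (W +ₛ ⟨ z ⟩) (exchange-⟨⟩ W x z (Z≤W+x z z∈Z) z∉W)))
      Z≤W+A : Z ≤ₛ W +ₛ A
      Z≤W+A = ≤ₛ-trans Z (W +ₛ ⟨ z ⟩) (W +ₛ A) Z≤W+z (+ₛ-monoʳ W ⟨ z ⟩ A (⟨⟩-least A z∈A))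
      T = (U +ₛ B) +ₛ ⟨ z ⟩
      U≤T : U ≤ₛ T
      U≤T = ≤ₛ-trans U (U +ₛ B) T (≤-+ₛˡ U B) (≤-+ₛˡ (U +ₛ B) ⟨ z ⟩)
      B≤T : B ≤ₛ T
      B≤T = ≤ₛ-trans B (U +ₛ B) T (≤-+ₛʳ U B) (≤-+ₛˡ (U +ₛ B) ⟨ z ⟩)
      -- Since `Z` is `W +ₛ ⟨ z ⟩` and `z` lies in `A`, the modular law places `A` inside
      -- `U +ₛ ⟨ z ⟩`.
      A≤T : A ≤ₛ T
      A≤T y y∈A = +ₛ-least U ⟨ z ⟩ T U≤T (≤-+ₛʳ (U +ₛ B) ⟨ z ⟩) y
        (modular-law A ⟨ z ⟩ W (⟨⟩-least A z∈A) y (y∈A , Z≤W+z y (A≤Z y y∈A)))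
      T≐Z : T ≐ₛ Z
      T≐Z = +ₛ-least (U +ₛ B) ⟨ z ⟩ Z U+B≤Z (⟨⟩-least Z z∈Z)
          , ≤ₛ-trans Z (A +ₛ B) T Z≤A+B (+ₛ-least A B T A≤T B≤T)
      -- `φ B` is carried along on both sides because cyclicity only speaks of subspaces that span
      -- `Z` together with one vector, such as `U +ₛ B`.
      ρA+φB≤ρU+φB : N.ρ A + φ B ℕ.≤ N.ρ U + φ B
      ρA+φB≤ρU+φB = begin
        N.ρ A + φ B   ≤⟨ ℕ.+-monoˡ-≤ (φ B) (ρ≤φ A) ⟩
        φ A + φ B     ≡⟨ φA+φB ⟩
        φ Z           ≤⟨ cyclic⇒φ≤ρ⊕ Z cyclic ⟩
        ρ⊕ Z          ≡⟨ ≡.sym (proj₂ (Z⊆cyc z∈Z) (U +ₛ B) U+B≤Z T≐Z) ⟩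
        ρ⊕ (U +ₛ B)   ≤⟨ ρ⊕≤φ (U +ₛ B) ⟩
        φ (U +ₛ B)    ≤⟨ φ-+-≤ U B ⟩
        φ U + φ B     ≤⟨ ℕ.+-monoˡ-≤ (φ B) (φ≤ρ-below U λ _ → proj₁) ⟩
        N.ρ U + φ B   ∎

    -- `Z` is the sum of `A` and `B`, its parts in the two blocks. If `W` misses a vector of either,
    -- `summand-≰⇒ρ≤` applies; otherwise `W` contains all of `Z`.
    cyclicFlat⇒cyclic : ∀ Z → 𝒵 (M₁ ⊕ M₂) Z → IsCyclic N Z
    cyclicFlat⇒cyclic Z cyclicFlat@(_ , cyclic) =
      proj₁ , λ {x} x∈Z → x∈Z , λ W W≤Z W+x≐Z →
        ℕ.≤-antisym (N.monotone W Z W≤Z) (ρZ≤ρW x W W+x≐Z)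
      where
      Z₁ = π₁ m Z
      Z₂ = π₂ m Z
      A = Z₁ ⊕ₛ 𝟎
      B = 𝟎 ⊕ₛ Z₂
      A≤Z : A ≤ₛ Z
      A≤Z = ≤ₛ-trans A (Z₁ ⊕ₛ Z₂) Z
        (⊕ₛ-mono Z₁ Z₁ 𝟎 Z₂ (λ _ p → p) (𝟎-least Z₂)) (cyclicFlat⇒split Z cyclicFlat)
      B≤Z : B ≤ₛ Z
      B≤Z = ≤ₛ-trans B (Z₁ ⊕ₛ Z₂) Z
        (⊕ₛ-mono 𝟎 Z₁ Z₂ Z₂ (𝟎-least Z₁) (λ _ p → p)) (cyclicFlat⇒split Z cyclicFlat)
      A+B≤Z : A +ₛ B ≤ₛ Z
      A+B≤Z = +ₛ-least A B Z A≤Z B≤Z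
      B+A≤Z : B +ₛ A ≤ₛ Z
      B+A≤Z = +ₛ-least B A Z B≤Z A≤Z
      Z≤A+B : Z ≤ₛ A +ₛ B
      Z≤A+B z z∈Z = proj₁ (⊕ₛ-+ₛ Z₁ 𝟎 𝟎 Z₂) z
        ( ≤-+ₛˡ Z₁ 𝟎 _ (z , z∈Z , ≋-refl)
        , ≤-+ₛʳ 𝟎 Z₂ _ (z , z∈Z , ≋-refl))
      Z≤B+A : Z ≤ₛ B +ₛ A
      Z≤B+A = ≤ₛ-trans Z (A +ₛ B) (B +ₛ A) Z≤A+B
        (+ₛ-least A B (B +ₛ A) (≤-+ₛʳ B A) (≤-+ₛˡ B A))
      φA+φB : φ A + φ B ≡ φ Z
      φA+φB = ≡.cong₂ _+_
        (≡.trans (φ-⊕ₛ Z₁ 𝟎) (≡.trans (≡.cong (M₁.ρ Z₁ +_) (ρ-𝟎 M₂)) (ℕ.+-identityʳ _)))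
        (≡.trans (φ-⊕ₛ 𝟎 Z₂) (≡.cong (_+ M₂.ρ Z₂) (ρ-𝟎 M₁)))
      ρZ≤ρW : ∀ x W → W +ₛ ⟨ x ⟩ ≐ₛ Z → N.ρ Z ℕ.≤ N.ρ W
      ρZ≤ρW x W W+x≐Z = go (≤ₛ-or-witness A W) (≤ₛ-or-witness B W)
        where
        go : A ≤ₛ W ⊎ (∃ λ a → a ∈ ⟦ A ⟧ × a ∉ ⟦ W ⟧) →
             B ≤ₛ W ⊎ (∃ λ b → b ∈ ⟦ B ⟧ × b ∉ ⟦ W ⟧) → N.ρ Z ℕ.≤ N.ρ W
        go (inj₂ (a , a∈A , a∉W)) _ =
          summand-≰⇒ρ≤ Z W x A B cyclic W+x≐Z (A+B≤Z , Z≤A+B) φA+φB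
            (λ U U≤A → φ≤ρ U (≤⊕𝟎⇒split Z₁ U U≤A)) a a∈A a∉W
        go (inj₁ _) (inj₂ (b , b∈B , b∉W)) =
          summand-≰⇒ρ≤ Z W x B A cyclic W+x≐Z (B+A≤Z , Z≤B+A)
            (≡.trans (ℕ.+-comm (φ B) (φ A)) φA+φB)
            (λ U U≤B → φ≤ρ U (≤𝟎⊕⇒split Z₂ U U≤B)) b b∈B b∉W
        go (inj₁ A≤W) (inj₁ B≤W) =
          N.monotone Z W (≤ₛ-trans Z (A +ₛ B) W Z≤A+B (+ₛ-least A B W A≤W B≤W))

    cyclicFlat⇒cyclicFlat : ∀ Z → 𝒵 (M₁ ⊕ M₂) Z → 𝒵 N Z
    cyclicFlat⇒cyclicFlat Z cyclicFlat = cyclicFlat⇒flat Z cyclicFlat , cyclicFlat⇒cyclic Z cyclicFlat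

-- Representations by vectors over the extension field.

module Realisations {q r : ℕ} (𝔽 : FiniteField q) (𝕂 : FiniteField r) where
  private
    module F = LinearAlgebra 𝔽
    module K = LinearAlgebra 𝕂
    module FS = SubspaceProperties 𝔽
    module KS = SubspaceProperties 𝕂
  open F using (Subspace; Vec; ⟦_⟧; ⟨_⟩; _≤ₛ_; _+ₛ_; _⊕ₛ_; π₁; π₂)
  open QMatroids 𝔽
  open QMatroidProperties 𝔽

  -- S V is the 𝕂-span of { act x ∣ x ∈ V }, with act x = G x for the q-matroid represented by G. With G
  -- left abstract the type checker does not unfold ranks of matrix products.
  record Realisation (M : QMatroid n) (k : ℕ) : Set₁ where
    open QMatroid M
    field
      act       : Vec n → K.Vec k
      act-cong  : ∀ x y → x F.≋ y → act x K.≋ act y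
      act-0     : act F.0ᵛ K.≋ K.0ᵛ
      act-+     : ∀ x y → act (x F.+ᵛ y) K.≋ act x K.+ᵛ act y
      act-⟨⟩    : ∀ x T → act x ∈ K.⟦ T ⟧ → ∀ y → y ∈ ⟦ ⟨ x ⟩ ⟧ → act y ∈ K.⟦ T ⟧
      S         : Subspace n → K.Subspace k
      act∈S     : ∀ V x → x ∈ ⟦ V ⟧ → act x ∈ K.⟦ S V ⟧
      S-least   : ∀ V T → (∀ x → x ∈ ⟦ V ⟧ → act x ∈ K.⟦ T ⟧) → S V K.≤ₛ T
      ρ≡dim-S   : ∀ V → ρ V ≡ K.dim (S V)

    S-mono : ∀ V W → V ≤ₛ W → S V K.≤ₛ S W
    S-mono V W V≤W = S-least V (S W) λ x x∈V → act∈S W x (V≤W x x∈V)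

    act∈S⇒ρ-+⟨⟩≤ : ∀ V x → act x ∈ K.⟦ S V ⟧ → ρ (V +ₛ ⟨ x ⟩) ℕ.≤ ρ V
    act∈S⇒ρ-+⟨⟩≤ V x Gx∈ = ≡.subst₂ ℕ._≤_ (≡.sym (ρ≡dim-S (V +ₛ ⟨ x ⟩))) (≡.sym (ρ≡dim-S V))
      (K.dim-mono (S (V +ₛ ⟨ x ⟩)) (S V)
        (S-least (V +ₛ ⟨ x ⟩) (S V) λ y (v , v∈V , w , w∈⟨x⟩ , e) →
          K.resp (S V) (K.≋-trans (K.≋-sym (act-+ v w)) (act-cong (v F.+ᵛ w) y e))
            (K.+∈ (S V) (act∈S V v v∈V) (act-⟨⟩ x (S V) Gx∈ w w∈⟨x⟩))))

    -- The space `S V` lies in `S (V +ₛ ⟨ x ⟩)`, whose dimension is no larger, so the two coincide.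
    -- With the converse above, the closure of `V` consists of the x with `act x` in `S V`.
    ρ-+⟨⟩≤⇒act∈S : ∀ V x → ρ (V +ₛ ⟨ x ⟩) ℕ.≤ ρ V → act x ∈ K.⟦ S V ⟧
    ρ-+⟨⟩≤⇒act∈S V x ρ≤ = KS.dim≥⇒≥ (S V) (S V+x) (S-mono V V+x (FS.≤-+ₛˡ V ⟨ x ⟩))
      (≡.subst₂ ℕ._≤_ (ρ≡dim-S V+x) (ρ≡dim-S V) ρ≤)
      (act x) (act∈S V+x x (FS.≤-+ₛʳ V ⟨ x ⟩ x (FS.x∈⟨x⟩ x)))
      where V+x = V +ₛ ⟨ x ⟩

  module BlockRealisation {a₁ a₂ n₁ n₂ : ℕ}
    {M₁ : QMatroid n₁} {M₂ : QMatroid n₂} {N : QMatroid (n₁ + n₂)}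
    (R₁ : Realisation M₁ a₁) (R₂ : Realisation M₂ a₂) (R : Realisation N (a₁ + a₂))
    (act-take : ∀ x → Realisation.act R x ∘ (_↑ˡ a₂) K.≋ Realisation.act R₁ (x ∘ (_↑ˡ n₂)))
    (act-drop : ∀ x → Realisation.act R x ∘ (a₁ ↑ʳ_) K.≋ Realisation.act R₂ (x ∘ (n₁ ↑ʳ_)))
    where
    open DirectSum M₁ M₂ using (φ)
    private
      module M₁ = QMatroid M₁
      module M₂ = QMatroid M₂
      module N = QMatroid N
      module R₁ = Realisation R₁
      module R₂ = Realisation R₂
      module R = Realisation R
      S₁ : Subspace (n₁ + n₂) → K.Subspace a₁
      S₁ V = R₁.S (π₁ n₁ V)
      S₂ : Subspace (n₁ + n₂) → K.Subspace a₂
      S₂ V = R₂.S (π₂ n₁ V)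

    S-≤ : ∀ V → R.S V K.≤ₛ S₁ V K.⊕ₛ S₂ V
    S-≤ V = R.S-least V (S₁ V K.⊕ₛ S₂ V) λ x x∈V →
        K.resp (S₁ V) (K.≋-sym (act-take x)) (R₁.act∈S (π₁ n₁ V) (x ∘ (_↑ˡ n₂)) (x , x∈V , F.≋-refl))
      , K.resp (S₂ V) (K.≋-sym (act-drop x)) (R₂.act∈S (π₂ n₁ V) (x ∘ (n₁ ↑ʳ_)) (x , x∈V , F.≋-refl))

    -- If G x lies in `R.S V`, its two blocks G₁ x₁ and G₂ x₂ lie in `S₁ V` and `S₂ V`.
    closure-π : ∀ V x → N.ρ (V +ₛ ⟨ x ⟩) ℕ.≤ N.ρ V →
                M₁.ρ (π₁ n₁ V +ₛ ⟨ x ∘ (_↑ˡ n₂) ⟩) ℕ.≤ M₁.ρ (π₁ n₁ V) ×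
                M₂.ρ (π₂ n₁ V +ₛ ⟨ x ∘ (n₁ ↑ʳ_) ⟩) ℕ.≤ M₂.ρ (π₂ n₁ V)
    closure-π V x ρ≤ = let p , r = S-≤ V (R.act x) (R.ρ-+⟨⟩≤⇒act∈S V x ρ≤) in
        R₁.act∈S⇒ρ-+⟨⟩≤ (π₁ n₁ V) (x ∘ (_↑ˡ n₂)) (K.resp (S₁ V) (act-take x) p)
      , R₂.act∈S⇒ρ-+⟨⟩≤ (π₂ n₁ V) (x ∘ (n₁ ↑ʳ_)) (K.resp (S₂ V) (act-drop x) r)

    ρ≤φ : ∀ V → N.ρ V ℕ.≤ φ V
    ρ≤φ V = begin
      N.ρ V                         ≡⟨ R.ρ≡dim-S V ⟩
      K.dim (R.S V)                 ≤⟨ K.dim-mono (R.S V) (S₁ V K.⊕ₛ S₂ V) (S-≤ V) ⟩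
      K.dim (S₁ V K.⊕ₛ S₂ V)        ≡⟨ KS.dim-⊕ₛ (S₁ V) (S₂ V) ⟩
      K.dim (S₁ V) + K.dim (S₂ V)   ≡⟨ ≡.sym (≡.cong₂ _+_ (R₁.ρ≡dim-S (π₁ n₁ V)) (R₂.ρ≡dim-S (π₂ n₁ V))) ⟩
      φ V                           ∎
      where open ℕ.≤-Reasoning

    -- Split the dimension of `R.S V` into its first projection and the kernel of that projection.
    -- The former contains `S₁ V`; the latter contains `S₂ V`, as (0, y) lies in `V` for every y in
    -- the second projection.
    φ≤ρ : ∀ V → π₁ n₁ V ⊕ₛ π₂ n₁ V ≤ₛ V → φ V ℕ.≤ N.ρ V
    φ≤ρ V split = begin
      φ V                           ≡⟨ ≡.cong₂ _+_ (R₁.ρ≡dim-S (π₁ n₁ V)) (R₂.ρ≡dim-S (π₂ n₁ V)) ⟩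
      K.dim (S₁ V) + K.dim (S₂ V)   ≤⟨ ℕ.+-mono-≤ (K.dim-mono (S₁ V) (K.π₁ a₁ (R.S V)) S₁≤)
                                                  (K.dim-mono (S₂ V) (K.fibre a₁ (R.S V)) S₂≤) ⟩
      K.dim (K.π₁ a₁ (R.S V)) + K.dim (K.fibre a₁ (R.S V))
                                    ≡⟨ ≡.sym (K.dim-π₁+fibre a₁ (R.S V)) ⟩
      K.dim (R.S V)                 ≡⟨ ≡.sym (R.ρ≡dim-S V) ⟩
      N.ρ V                         ∎
      where
      open ℕ.≤-Reasoning
      S₁≤ : S₁ V K.≤ₛ K.π₁ a₁ (R.S V)
      S₁≤ = R₁.S-least (π₁ n₁ V) (K.π₁ a₁ (R.S V)) λ y (x , x∈V , e) →
        R.act x , R.act∈S V x x∈V ,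
        K.≋-trans (act-take x) (R₁.act-cong (x ∘ (_↑ˡ n₂)) y e)
      S₂≤ : S₂ V K.≤ₛ K.fibre a₁ (R.S V)
      S₂≤ = R₂.S-least (π₂ n₁ V) (K.fibre a₁ (R.S V)) λ y y∈π₂V →
        let x = F.0ᵛ {n₁} Vector.++ y
            x∈V = split x (FS.++-∈ (π₁ n₁ V) (π₂ n₁ V) (F.0∈ (π₁ n₁ V)) y∈π₂V)
        in R.act x ,
           ( R.act∈S V x x∈V
           , K.≋-trans (act-take x)
               (K.≋-trans (R₁.act-cong (x ∘ (_↑ˡ n₂)) F.0ᵛ (FS.take-++ F.0ᵛ y)) R₁.act-0)
           , _ ) ,
           K.≋-trans (act-drop x) (R₂.act-cong (x ∘ (n₁ ↑ʳ_)) y (FS.drop-++ (F.0ᵛ {n₁}) y))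

    open BlockSum M₁ M₂ N ρ≤φ φ≤ρ closure-π public
      using (⊕ₛ-flat; ⊕ₛ-open; cyclicFlat⇒cyclicFlat; independent⇒independent⊕)

-- Block diagonal matrices as block sums.

module RepresentationProperties {q r : ℕ} {𝔽 : FiniteField q} {𝕂 : FiniteField r}
                                (𝕂/𝔽 : FieldExtension 𝔽 𝕂) where
  private
    module F = LinearAlgebra 𝔽
    module K = LinearAlgebra 𝕂
    module KS = SubspaceProperties 𝕂
  open Representation 𝕂/𝔽
  open Realisations 𝔽 𝕂
  open FieldExtension 𝕂/𝔽 using (embed)

  -- Spelt with the qualified name so that all occurrences of the represented q-matroids below agree
  -- syntactically, which spares comparing them by unfolding.
  realisation : (G : K.Matrix k n) → Realisations.Realisation 𝔽 𝕂 (Representation.representedBy 𝕂/𝔽 G) k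
  realisation G = record
    { act      = act G
    ; act-cong = λ x y → act-cong G
    -- The zero vector is the linear combination of no vectors.
    ; act-0    = K.≋-trans (act-lincomb G {l = 0} Vector.[] Vector.[]) (λ _ → K.refl)
    ; act-+    = act-+ G
    ; act-⟨⟩   = λ x T Gx∈T y y∈⟨x⟩ → productSpace-least G (x Vector.∷ Vector.[]) T (λ { zero → Gx∈T })
                   (act G y) (act-∈ G (x Vector.∷ Vector.[]) y y∈⟨x⟩)
    ; S        = λ V → productSpace G (F.basisMatrix V)
    ; act∈S    = λ V x x∈V → act-∈ G (F.basisMatrix V) x (proj₂ (F.Basis.spanning (F.basis V)) x x∈V)
    ; S-least  = λ V T V→T → productSpace-least G (F.basisMatrix V) T λ i → V→T _ (F.basis∈ V i)
    ; ρ≡dim-S  = λ V → ≡.refl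
    }

  module BlockDiagonal {a₁ a₂ n₁ n₂ : ℕ} (G₁ : K.Matrix a₁ n₁) (G₂ : K.Matrix a₂ n₂) where
    private
      G : K.Matrix (a₁ + a₂) (n₁ + n₂)
      G = K.blockDiagonal G₁ G₂

    -- An upper row of `G` is a row of `G₁` followed by zeros, so the second half of the sum
    -- vanishes.
    act-take : ∀ x → act G x ∘ (_↑ˡ a₂) K.≋ act G₁ (x ∘ (_↑ˡ n₂))
    act-take x i = K.trans (KS.sum-++ n₁ (λ h → G (i ↑ˡ a₂) h K.* embed (x h))) (K.trans
      (K.+-cong
        (K.sum-cong-≋ λ h → K.*-congʳ (K.trans (row (h ↑ˡ n₂)) (KS.take-++ (G₁ i) (K.0ᵛ {n₂}) h)))
        (K.trans (K.sum-cong-≋ λ h → K.trans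
          (K.*-congʳ (K.trans (row (n₁ ↑ʳ h)) (KS.drop-++ (G₁ i) (K.0ᵛ {n₂}) h))) (K.zeroˡ _))
          (K.sum-replicate-zero n₂)))
      (K.+-identityʳ _))
      where
      row : ∀ h → G (i ↑ˡ a₂) h K.≈ (G₁ i Vector.++ K.0ᵛ {n₂}) h
      row h = K.reflexive (≡.cong (λ g → g h)
        (Vector.lookup-++ˡ (Vector.map (Vector._++ K.0ᵛ) G₁) (Vector.map (K.0ᵛ Vector.++_) G₂) i))

    act-drop : ∀ x → act G x ∘ (a₁ ↑ʳ_) K.≋ act G₂ (x ∘ (n₁ ↑ʳ_))
    act-drop x i = K.trans (KS.sum-++ n₁ (λ h → G (a₁ ↑ʳ i) h K.* embed (x h))) (K.trans
      (K.+-cong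
        (K.trans (K.sum-cong-≋ λ h → K.trans
          (K.*-congʳ (K.trans (row (h ↑ˡ n₂)) (KS.take-++ (K.0ᵛ {n₁}) (G₂ i) h))) (K.zeroˡ _))
          (K.sum-replicate-zero n₁))
        (K.sum-cong-≋ λ h → K.*-congʳ (K.trans (row (n₁ ↑ʳ h)) (KS.drop-++ (K.0ᵛ {n₁}) (G₂ i) h))))
      (K.+-identityˡ _))
      where
      row : ∀ h → G (a₁ ↑ʳ i) h K.≈ (K.0ᵛ {n₁} Vector.++ G₂ i) h
      row h = K.reflexive (≡.cong (λ g → g h)
        (Vector.lookup-++ʳ (Vector.map (Vector._++ K.0ᵛ) G₁) (Vector.map (K.0ᵛ Vector.++_) G₂) i))

    open BlockRealisation (realisation G₁) (realisation G₂) (realisation G) act-take act-drop public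
      using (⊕ₛ-flat; ⊕ₛ-open; cyclicFlat⇒cyclicFlat; independent⇒independent⊕)
    open QMatroidProperties.DirectSumProperties 𝔽
      (Representation.representedBy 𝕂/𝔽 G₁) (Representation.representedBy 𝕂/𝔽 G₂) public
      using (ρ⊕-unique; ρ⊕-relate)

theorem6p6 :
  ∀ {q m : ℕ} (𝔽 : FiniteField q) (𝕂 : FiniteField (q ^ m)) (𝕂/𝔽 : FieldExtension 𝔽 𝕂)
    {a₁ a₂ n₁ n₂ : ℕ}
    (G₁ : LinearAlgebra.Matrix 𝕂 a₁ n₁) (G₂ : LinearAlgebra.Matrix 𝕂 a₂ n₂) →
  LinearAlgebra.FullRowRank 𝕂 G₁ → LinearAlgebra.FullRowRank 𝕂 G₂ →
  let open LinearAlgebra 𝔽 hiding (_+_)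
      open QMatroids 𝔽
      open Representation 𝕂/𝔽

      G : LinearAlgebra.Matrix 𝕂 (a₁ + a₂) (n₁ + n₂)
      G = LinearAlgebra.blockDiagonal 𝕂 G₁ G₂

      M₁ : QMatroid n₁
      M₁ = representedBy G₁

      M₂ : QMatroid n₂
      M₂ = representedBy G₂

      N : QMatroid (n₁ + n₂)
      N = representedBy G
  in
    (∀ (F₁ : Subspace n₁) (F₂ : Subspace n₂) →
       IsFlat M₁ F₁ → IsFlat M₂ F₂ → IsFlat N (F₁ ⊕ₛ F₂))
  × (∀ (O₁ : Subspace n₁) (O₂ : Subspace n₂) →
       IsOpen M₁ O₁ → IsOpen M₂ O₂ → IsOpen N (O₁ ⊕ₛ O₂))
  × (∀ (Z : Subspace (n₁ + n₂)) → 𝒵 (M₁ ⊕ M₂) Z → 𝒵 N Z)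
  × (∀ (V : Subspace (n₁ + n₂)) → IsIndependent N V → IsIndependent (M₁ ⊕ M₂) V)
theorem6p6 𝔽 𝕂 𝕂/𝔽 G₁ G₂ _ _ =
    ⊕ₛ-flat
  , ⊕ₛ-open
  , (λ Z (flat , cyclic) → cyclicFlat⇒cyclicFlat Z
      -- Flatness and cyclicity are carried between two spellings of the same direct sum rank; their
      -- content is unchanged.
      ( (λ x x∉Z → ρ⊕-relate ℕ._<_ Z (LinearAlgebra._+ₛ_ 𝔽 Z (LinearAlgebra.⟨_⟩ 𝔽 x)) (flat x x∉Z)
          ≡.refl ≡.refl ≡.refl ≡.refl)
      , proj₁ , λ x∈Z → x∈Z , λ W W≤Z W+x≐Z →
          ρ⊕-relate _≡_ W Z (proj₂ (proj₂ cyclic x∈Z) W W≤Z W+x≐Z)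
            ≡.refl ≡.refl ≡.refl ≡.refl))
  , λ V indep → ≡.trans (ρ⊕-unique V ≡.refl ≡.refl) (independent⇒independent⊕ V indep)
  where open RepresentationProperties.BlockDiagonal 𝕂/𝔽 G₁ G₂
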